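{- Let $m\in\mathbb{N}$, let $h:\mathbb{N}^m\to\mathbb{N}$ be a polynomial having no constant term, and let $p_1,\ldots,p_m$ be minimal idempotents in $(\beta\mathbb{N},+)$. Then for every $A\in\tilde h\left(\bigotimes_{i=1}^m p_i\right)$ and every $T\in\mathcal{P}_f(\mathbb{P})$ there exist functions $\alpha_1,\ldots,\alpha_m:\mathcal{P}_f(\mathbb{N}^{\mathbb{N}})\to\mathbb{N}$ and $H_1,\ldots,H_m:\mathcal{P}_f(\mathbb{N}^{\mathbb{N}})\to\mathcal{P}_f(\mathbb{N})$ such that (1) if $G,K\in\mathcal{P}_f(\mathbb{N}^{\mathbb{N}})$ and $G\subsetneq K$, then $H_i(G)<H_i(K)$ for each $i\in\{1,\ldots,m\}$; (2) if $G_1\subsetneq G_2\subsetneq\cdots\subsetneq G_n\subsetneq\cdots$ is an infinite sequence in $\mathcal{P}_f(\mathbb{N}^{\mathbb{N}})$, then for all $\beta_1<\beta_2<\cdots<\beta_m$ in $\mathcal{P}_f(\mathbb{N})$, all $f_i\in G_i$ ($i\in\mathbb{N}$), and all $P_1,\ldots,P_m\in T$, $$h\left(\sum_{i\in\beta_1}\alpha_1(G_i)+P_1\Bigl(\sum_{i\in\beta_1}\sum_{t\in H_1(G_i)}f_i(t)\Bigr),\ldots,\sum_{i\in\beta_m}\alpha_m(G_i)+P_m\Bigl(\sum_{i\in\beta_m}\sum_{t\in H_m(G_i)}f_i(t)\Bigr)\right)\in A;$$ (3) if there is a minimal idempotent $p$ with $p_i=p$ for each $i\in\{1,\ldots,m\}$,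 then the functions can be chosen so that $\alpha_i=\alpha$ and $H_i=H$ for all $i$, for some functions $\alpha:\mathcal{P}_f(\mathbb{N}^{\mathbb{N}})\to\mathbb{N}$ and $H:\mathcal{P}_f(\mathbb{N}^{\mathbb{N}})\to\mathcal{P}_f(\mathbb{N})$. In fact, the same holds for idempotents of $(\mathcal{J}_p,+)$ in place of minimal idempotents.
   Context: $\mathbb{N}$ is the set of positive integers; $\mathcal{P}_f(X)$ is the set of nonempty finite subsets of $X$; $\mathbb{N}^{\mathbb{N}}$ is the set of all functions $\mathbb{N}\to\mathbb{N}$. For $\beta,\gamma\in\mathcal{P}_f(\mathbb{N})$, $\beta<\gamma$ means $\max\beta<\min\gamma$. $\mathbb{P}$ is the set of one-variable polynomials with integer coefficients and zero constant term. $\beta X$ denotes the set of ultrafilters on a discrete set $X$ (Stone–Čech compactification). On $\beta\mathbb{N}$: $A\in p+q$ iff $\{x\in\mathbb{N}:-x+A\in q\}\in p$, where $-x+A=\{y\in\mathbb{N}:x+y\in A\}$. An ultrafilter $p$ is idempotent if $p+p=p$; a minimal idempotent is an idempotent lying in $K(\beta\mathbb{N},+)$, the smallest two-sided ideal (the union of all minimal left ideals) of $(\beta\mathbb{N},+)$. For a map $h:\mathbb{N}^m\to\mathbb{N}$, $\tilde h:\beta(\mathbb{N}^m)\to\beta\mathbb{N}$ is its continuous extension: $A\in\tilde h(u)$ iff $h^{ -1}(A)\in u$. Since $h$ is defined on $\mathbb{N}^m$, writing $h(u_1,\ldots,u_m)\in A$ includes that $u_1,\ldots,u_m\in\mathbb{N}$.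 A set $A\subseteq\mathbb{N}$ is a $J_p$-set if for every $F\in\mathcal{P}_f(\mathbb{P})$ and every $H\in\mathcal{P}_f(\mathbb{N}^{\mathbb{N}})$ there exist $a\in\mathbb{N}$ and $\beta\in\mathcal{P}_f(\mathbb{N})$ such that $a+P(\sum_{t\in\beta}f(t))\in A$ for all $P\in F$ and $f\in H$. $\mathcal{J}_p=\{q\in\beta\mathbb{N}:\text{every }A\in q\text{ is a }J_p\text{ -set}\}$ (the subscript $p$ stands for "polynomial" and is not an ultrafilter); it is a two-sided ideal of $(\beta\mathbb{N},+)$. Tensor products: for ultrafilters $p_1,\ldots,p_k$ on $\mathbb{N}$, $\bigotimes_{i=1}^k p_i$ is the ultrafilter on $\mathbb{N}^k$ defined recursively by $\bigotimes_{i=1}^1p_i=p_1$, and, for $A\subseteq\mathbb{N}^{k+1}$, $A\in\bigotimes_{i=1}^{k+1}p_i$ iff $\{(x_1,\ldots,x_k)\in\mathbb{N}^k:\{x_{k+1}\in\mathbb{N}:(x_1,\ldots,x_{k+1})\in A\}\in p_{k+1}\}\in\bigotimes_{i=1}^kp_i$. -}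

module Defs where

open import Data.Fin.Base as Fin using (Fin; fromℕ; inject₁)
open import Data.Integer.Base as ℤ using (ℤ; +_)
open import Data.List.Base as List using (List; []; _∷_)
open import Data.List.NonEmpty.Base as List⁺ using (List⁺; toList)
open import Data.List.Membership.Propositional using () renaming (_∈_ to _∈ˡ_)
open import Data.List.Relation.Unary.All using (All)
open import Data.List.Relation.Unary.AllPairs using (AllPairs)
import Data.List.Membership.Setoid as SetoidMembership
import Data.List.Relation.Binary.Subset.Setoid as SetoidSubset
open import Data.Nat.Base as ℕ using (ℕ; zero; suc)
open import Data.Nat.ListAction using (sum)
open import Data.Product.Base using (Σ-syntax; ∃; ∃-syntax; _×_; _,_; proj₁; proj₂)
open import Data.Rational.Base as ℚ using (ℚ; 0ℚ)
open import Data.Sum.Base using (_⊎_; inj₁; inj₂)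
open import Data.Vec.Base as Vec using (Vec; []; _∷_; _∷ʳ_)
open import Function.Base using (_∘_; _on_)
open import Function.Bundles using (_⟶ₛ_; _⟨$⟩_)
open import Level using (Level; 0ℓ) renaming (suc to lsuc)
open import Relation.Binary.Bundles using (Setoid)
import Relation.Binary.Construct.On as On
open import Relation.Binary.PropositionalEquality using (_≡_; _≢_; _→-setoid_; setoid)
open import Relation.Nullary.Negation using (¬_)
open import Relation.Unary using (Pred; ∅; U; ∁; _∈_; _∩_; _⊆_; _≐_)

private
  variable
    X Y Z : Set

1ℓ : Level
1ℓ = lsuc 0ℓ

------------------------------------------------------------------------
-- Positive integers; `1+ n` stands for n + 1.

infix 8 1+_

record ℕ⁺ : Set where
  constructor 1+_
  field
    pred : ℕ

toℕ : ℕ⁺ → ℕ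
toℕ (1+ n) = suc n

infixl 6 _+⁺_

_+⁺_ : ℕ⁺ → ℕ⁺ → ℕ⁺
(1+ a) +⁺ (1+ b) = 1+ (a ℕ.+ suc b)

suc⁺ : ℕ⁺ → ℕ⁺
suc⁺ (1+ n) = 1+ suc n

-- For an integer z and A ⊆ ℕ⁺, "z ∈ A" includes the claim that z is positive.

infix 4 _∈ᶻ_

_∈ᶻ_ : ℤ → Pred ℕ⁺ 0ℓ → Set
z ∈ᶻ A = ∃[ n ] (+ toℕ n ≡ z × n ∈ A)

------------------------------------------------------------------------
-- Nonempty finite sets.  Where only quantification over the elements
-- matters, a nonempty finite set is a nonempty list.  Nonempty finite
-- sets of positive integers are summed over, so they are represented
-- without repetition, by strictly increasing lists.

infix 4 _∈⁺_

_∈⁺_ : X → List⁺ X → Set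
x ∈⁺ xs = x ∈ˡ toList xs

record 𝒫fℕ : Set where
  field
    elements   : List⁺ ℕ⁺
    increasing : AllPairs (ℕ._<_ on toℕ) (toList elements)

open 𝒫fℕ public

-- Increasing lists are equal exactly when they have the same elements.

𝒫fℕ-setoid : Setoid 0ℓ 0ℓ
𝒫fℕ-setoid = On.setoid (setoid (List⁺ ℕ⁺)) elements

max min : 𝒫fℕ → ℕ
max β = List⁺.foldr₁ ℕ._⊔_ (List⁺.map toℕ (elements β))
min β = List⁺.foldr₁ ℕ._⊓_ (List⁺.map toℕ (elements β))

infix 4 _≺_

_≺_ : 𝒫fℕ → 𝒫fℕ → Set
β ≺ γ = max β ℕ.< min γ

∑ : 𝒫fℕ → (ℕ⁺ → ℕ) → ℕ
∑ β f = sum (List.map f (toList (elements β)))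

infix 5 ∑
syntax ∑ β (λ t → e) = ∑[ t ∈ β ] e

------------------------------------------------------------------------
-- Nonempty finite sets of functions ℕ⁺ → ℕ⁺, functions being equal when
-- they are pointwise equal, and sets when they have the same elements.

ℕ⁺^ℕ⁺ : Setoid 0ℓ 0ℓ
ℕ⁺^ℕ⁺ = ℕ⁺ →-setoid ℕ⁺

𝒫fFun : Set
𝒫fFun = List⁺ (ℕ⁺ → ℕ⁺)

infix 4 _∈ᶠ_ _⊆ᶠ_ _⊊ᶠ_ _≐ᶠ_

_∈ᶠ_ : (ℕ⁺ → ℕ⁺) → 𝒫fFun → Set
f ∈ᶠ G = SetoidMembership._∈_ ℕ⁺^ℕ⁺ f (toList G)

_⊆ᶠ_ _⊊ᶠ_ _≐ᶠ_ : 𝒫fFun → 𝒫fFun → Set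
G ⊆ᶠ K = SetoidSubset._⊆_ ℕ⁺^ℕ⁺ (toList G) (toList K)
G ⊊ᶠ K = G ⊆ᶠ K × ¬ (K ⊆ᶠ G)
G ≐ᶠ K = G ⊆ᶠ K × K ⊆ᶠ G

𝒫fFun-setoid : Setoid 0ℓ 0ℓ
𝒫fFun-setoid = record
  { Carrier       = 𝒫fFun
  ; _≈_           = _≐ᶠ_
  ; isEquivalence = record
    { refl  = (λ p → p) , (λ p → p)
    ; sym   = λ { (p , q) → q , p }
    ; trans = λ { (p , q) (r , s) → (λ x → r (p x)) , (λ x → q (s x)) }
    }
  }

------------------------------------------------------------------------
-- Polynomials

-- c₁ ∷ c₂ ∷ … ∷ c_d ∷ [] is c₁x + c₂x² + … + c_d x^d: there is no slot
-- for a constant term.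

ℙ : Set
ℙ = List ℤ

eval : ℙ → ℤ → ℤ
eval []       x = + 0
eval (c ∷ cs) x = x ℤ.* (c ℤ.+ eval cs x)

-- (c , e₁ ∷ … ∷ e_m ∷ []) is the term c x₁^e₁ ⋯ x_m^e_m.

Term : ℕ → Set
Term m = ℚ × Vec ℕ m

monomial : ∀ {m} → Vec ℕ m → Vec ℕ⁺ m → ℕ
monomial e x = Vec.foldr′ ℕ._*_ 1 (Vec.zipWith ℕ._^_ (Vec.map toℕ x) e)

evalTerms : ∀ {m} → List (Term m) → Vec ℕ⁺ m → ℚ
evalTerms []             x = 0ℚ
evalTerms ((c , e) ∷ ts) x = c ℚ.* (+ monomial e x ℚ./ 1) ℚ.+ evalTerms ts x

-- Rational coefficients: a polynomial map sending ℕ^m into ℕ has these in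
-- whatever field of characteristic zero its coefficients are first taken.

IsPolynomialWithoutConstantTerm : ∀ {m} → (Vec ℕ⁺ m → ℕ⁺) → Set
IsPolynomialWithoutConstantTerm {m} h =
  Σ[ ts ∈ List (Term m) ]
    All (λ t → proj₂ t ≢ Vec.replicate m 0) ts ×
    (∀ x → + toℕ (h x) ℚ./ 1 ≡ evalTerms ts x)

------------------------------------------------------------------------
-- Ultrafilters

record Ultrafilter (X : Set) : Set₁ where
  field
    sets   : Pred (Pred X 0ℓ) 0ℓ
    whole  : U ∈ sets
    proper : ¬ (∅ ∈ sets)
    upward : ∀ {A B} → A ⊆ B → A ∈ sets → B ∈ sets
    inter  : ∀ {A B} → A ∈ sets → B ∈ sets → (A ∩ B) ∈ sets
    ultra  : ∀ A → A ∈ sets ⊎ ∁ A ∈ sets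

open Ultrafilter public

infix 4 _∈ᵘ_ _≈ᵘ_

_∈ᵘ_ : Pred X 0ℓ → Ultrafilter X → Set
A ∈ᵘ u = A ∈ sets u

_≈ᵘ_ : Ultrafilter X → Ultrafilter X → Set₁
u ≈ᵘ v = sets u ≐ sets v

-- The extension of h to ultrafilters: A ∈ h~ u iff h⁻¹(A) ∈ u.

_~ : (X → Y) → Ultrafilter X → Ultrafilter Y
(h ~) u = record
  { sets   = λ A → (A ∘ h) ∈ᵘ u
  ; whole  = whole u
  ; proper = proper u
  ; upward = λ A⊆B → upward u A⊆B
  ; inter  = inter u
  ; ultra  = λ A → ultra u (A ∘ h)
  }

-- A ∈ combine _∙_ p q iff {x : {y : x ∙ y ∈ A} ∈ q} ∈ p.

combine : (X → Y → Z) → Ultrafilter X → Ultrafilter Y → Ultrafilter Z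
combine _∙_ p q = record
  { sets   = λ A → (λ x → (λ y → A (x ∙ y)) ∈ᵘ q) ∈ᵘ p
  ; whole  = upward p (λ _ → whole q) (whole p)
  ; proper = λ ∅∈ → proper p (upward p (proper q) ∅∈)
  ; upward = λ A⊆B → upward p (upward q A⊆B)
  ; inter  = λ A∈ B∈ → upward p (λ { (a , b) → inter q a b }) (inter p A∈ B∈)
  ; ultra  = λ A → dichotomy A (ultra p (λ x → (λ y → A (x ∙ y)) ∈ᵘ q))
  }
  where
  flip-∁ : ∀ {B} → ¬ (B ∈ᵘ q) → ∁ B ∈ᵘ q
  flip-∁ {B} B∉ with ultra q B
  ... | inj₂ ∁B∈ = ∁B∈
  ... | inj₁ B∈  with () ← B∉ B∈

  dichotomy : ∀ A → let S = λ x → (λ y → A (x ∙ y)) ∈ᵘ q in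
              S ∈ᵘ p ⊎ ∁ S ∈ᵘ p →
              S ∈ᵘ p ⊎ (λ x → (λ y → ∁ A (x ∙ y)) ∈ᵘ q) ∈ᵘ p
  dichotomy A (inj₁ S∈)  = inj₁ S∈
  dichotomy A (inj₂ ∁S∈) = inj₂ (upward p flip-∁ ∁S∈)

βℕ : Set₁
βℕ = Ultrafilter ℕ⁺

infixl 6 _⊕_

_⊕_ : βℕ → βℕ → βℕ
_⊕_ = combine _+⁺_

Idempotent : Pred βℕ 1ℓ
Idempotent p = p ⊕ p ≈ᵘ p

-- p₁ ⊗ ⋯ ⊗ p_m, where p_i is p (i - 1).

⨂ : ∀ {m} .{{_ : ℕ.NonZero m}} → (Fin m → βℕ) → Ultrafilter (Vec ℕ⁺ m)
⨂ {suc zero}    p = ((_∷ []) ~) (p Fin.zero)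
⨂ {suc (suc k)} p = combine _∷ʳ_ (⨂ (p ∘ inject₁)) (p (fromℕ (suc k)))

------------------------------------------------------------------------
-- The smallest ideal and the ideal 𝒥ₚ

record IsTwoSidedIdeal (I : Pred βℕ 1ℓ) : Set₁ where
  field
    nonempty : ∃ I
    resp     : ∀ {p q} → p ≈ᵘ q → p ∈ I → q ∈ I
    left     : ∀ q {p} → p ∈ I → (q ⊕ p) ∈ I
    right    : ∀ q {p} → p ∈ I → (p ⊕ q) ∈ I

-- The smallest two-sided ideal, as the intersection of all of them.

K : Pred βℕ (lsuc 1ℓ)
K p = ∀ I → IsTwoSidedIdeal I → p ∈ I

MinimalIdempotent : Pred βℕ (lsuc 1ℓ)
MinimalIdempotent p = p ∈ K × p ∈ Idempotent

IsJₚ : Pred ℕ⁺ 0ℓ → Set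
IsJₚ A = (F : List⁺ ℙ) (H : 𝒫fFun) →
  ∃[ a ] ∃[ β ] (∀ P f → P ∈⁺ F → f ∈ᶠ H →
    + toℕ a ℤ.+ eval P (+ (∑[ t ∈ β ] toℕ (f t))) ∈ᶻ A)

𝒥ₚ : Pred βℕ 1ℓ
𝒥ₚ q = ∀ A → A ∈ᵘ q → IsJₚ A

𝒥ₚ-Idempotent : Pred βℕ 1ℓ
𝒥ₚ-Idempotent p = p ∈ 𝒥ₚ × p ∈ Idempotent

------------------------------------------------------------------------
-- The conclusion.  The functions α_i and H_i are setoid maps: their values
-- at a finite set do not depend on the list representing it.

𝒫fFun⟶ℕ⁺ 𝒫fFun⟶𝒫fℕ : Set
𝒫fFun⟶ℕ⁺  = 𝒫fFun-setoid ⟶ₛ setoid ℕ⁺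
𝒫fFun⟶𝒫fℕ = 𝒫fFun-setoid ⟶ₛ 𝒫fℕ-setoid

Increasing : ∀ {m} → (Fin m → 𝒫fFun⟶𝒫fℕ) → Set
Increasing H = ∀ G K → G ⊊ᶠ K → ∀ i → H i ⟨$⟩ G ≺ H i ⟨$⟩ K

-- h at an integer vector z lies in A; this includes that z is positive.

_at_∈ᶻ_ : ∀ {m} → (Vec ℕ⁺ m → ℕ⁺) → (Fin m → ℤ) → Pred ℕ⁺ 0ℓ → Set
h at z ∈ᶻ A = ∃[ u ] ((∀ i → + toℕ (Vec.lookup u i) ≡ z i) × h u ∈ A)

Captures : ∀ {m} → (Vec ℕ⁺ m → ℕ⁺) → Pred ℕ⁺ 0ℓ → List⁺ ℙ →
           (Fin m → 𝒫fFun⟶ℕ⁺) → (Fin m → 𝒫fFun⟶𝒫fℕ) → Set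
Captures {m} h A T α H =
  (G : ℕ⁺ → 𝒫fFun) → (∀ n → G n ⊊ᶠ G (suc⁺ n)) →
  (β : Fin m → 𝒫fℕ) → (∀ j k → j Fin.< k → β j ≺ β k) →
  (f : ℕ⁺ → ℕ⁺ → ℕ⁺) → (∀ i → f i ∈ᶠ G i) →
  (P : Fin m → ℙ) → (∀ j → P j ∈⁺ T) →
  h at (λ j →
      + (∑[ i ∈ β j ] toℕ (α j ⟨$⟩ G i))
      ℤ.+ eval (P j) (+ (∑[ i ∈ β j ] ∑[ t ∈ H j ⟨$⟩ G i ] toℕ (f i t))))
    ∈ᶻ A

Uniform : ∀ {m} → (Fin m → 𝒫fFun⟶ℕ⁺) → (Fin m → 𝒫fFun⟶𝒫fℕ) → Set
Uniform α H =
  Σ[ α₀ ∈ 𝒫fFun⟶ℕ⁺ ] Σ[ H₀ ∈ 𝒫fFun⟶𝒫fℕ ] (∀ i G →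
    α i ⟨$⟩ G ≡ α₀ ⟨$⟩ G × elements (H i ⟨$⟩ G) ≡ elements (H₀ ⟨$⟩ G))

{-# OPTIONS --safe #-}

-- Write h⁻¹(A) ∈ p₁ ⊗ ⋯ ⊗ pₘ as a tree: x₁ ranges over a member of p₁, then x₂ over a member of
-- p₂ depending on x₁, and so on.  The values α(G), H(G) are chosen by well-founded recursion on
-- ⊊.  At G there are finitely many positions to extend, one for every chain of proper subsets of
-- G, every choice of functions in it and of polynomials.  Since C* = {x ∈ C : -x + C ∈ p}
-- satisfies -x + C* ∈ p for x ∈ C*, each position asks for an element of a member of p, and as
-- P(n + y) - P(n) is again a polynomial in y without constant term, the Jₚ-property of the
-- intersection of these members gives α(G) and H(G).
--
-- Minimal idempotents lie in 𝒥ₚ because, for fixed F and H, the ultrafilters all of whose members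
-- contain a configuration for F and H form a two-sided ideal.  That it is nonempty is the IP
-- polynomial van der Waerden theorem, proved by PET induction with colour focusing, together with
-- the ultrafilter lemma.  The latter needs no further axiom, since excluded middle for arbitrary
-- types yields choice functions.
module Submission where

open import Defs
open import Axiom.ExcludedMiddle using (ExcludedMiddle)
open import Axiom.Extensionality.Propositional using (Extensionality)
open import Data.Bool.Base using (Bool; true; false; T)
open import Data.Empty using (⊥-elim)
open import Data.Fin.Base as Fin using (Fin; funToFin; finToFun; fromℕ; inject₁)
import Data.Fin.Properties as Finₚ
open import Data.Integer.Base as ℤ using (ℤ; +_; -[1+_]; _+_; _-_; _*_; -_; ∣_∣)
import Data.Integer.Properties as ℤₚ
open import Data.Integer.Tactic.RingSolver using (solve-∀)
open import Data.List.Base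
  using (List; []; _∷_; _++_; _∷ʳ_; cartesianProduct; cartesianProductWith; concat; concatMap;
         filter; length; lookup; map; replicate)
open import Data.List.Membership.Propositional using (find) renaming (_∈_ to _∈ˡ_)
open import Data.List.Membership.Propositional.Properties
open import Data.List.NonEmpty.Base as List⁺ using (List⁺; toList; _∷_)
open import Data.List.Properties using (++-assoc; ++-identityʳ; length-++; map-++; map-cong; map-∘)
open import Data.List.Relation.Binary.Pointwise using (Pointwise; []; _∷_)
open import Data.List.Relation.Unary.All as All using (All; []; _∷_)
import Data.List.Relation.Unary.All.Properties as Allₚ
open import Data.List.Relation.Unary.AllPairs as AllPairs using (AllPairs; []; _∷_)
import Data.List.Relation.Unary.AllPairs.Properties as AllPairsₚ
open import Data.List.Relation.Unary.Any as Any using (Any; here; there; index)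
import Data.List.Relation.Unary.Any.Properties as Anyₚ
open import Data.List.Relation.Unary.Unique.Propositional using (Unique)
open import Data.Nat.Base as ℕ using (ℕ; zero; suc; _<_; _≤_; NonZero; s≤s; z≤n)
open import Data.Nat.ListAction using (sum)
open import Data.Nat.ListAction.Properties using (sum-++)
import Data.Nat.Properties as ℕₚ
open import Data.Product.Base using (Σ-syntax; ∃; ∃-syntax; _×_; _,_; proj₁; proj₂)
open import Data.Sum.Base as Sum using (_⊎_; inj₁; inj₂)
open import Data.Unit.Base using (⊤; tt)
open import Data.Vec.Base as Vec using (Vec; []; _∷_)
open import Function.Base using (_∘_; id; _on_)
open import Function.Bundles using (_⟨$⟩_)
open import Induction.WellFounded using (Acc; acc; WellFounded)
open import Level using (0ℓ)
open import Relation.Binary.Bundles using (Setoid)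
open import Relation.Binary.PropositionalEquality
open import Relation.Nullary using (¬_; Dec; yes; no)
open import Relation.Nullary.Decidable using (¬?; ⌊_⌋; fromWitness; toWitness)
open import Relation.Unary using (Pred; ∅; U; ∁; _∈_; _⊆_; _∩_; _∪_)

-- Functions of bounded degree on finite sequences

∂ : List ℕ⁺ → (List ℕ⁺ → ℤ) → List ℕ⁺ → ℤ
∂ γ φ β = φ (γ ++ β) - φ γ - φ β

-- These are the VIP systems. Since `∂` also subtracts `φ β`, degree 0 means identically zero and
-- degree 1 means additive.
data Degree≤ : ℕ → (List ℕ⁺ → ℤ) → Set where
  vanishes : ∀ {φ} → (∀ β → φ β ≡ + 0) → Degree≤ 0 φ
  derived  : ∀ {d φ} → (∀ γ → Degree≤ d (∂ γ φ)) → Degree≤ (suc d) φ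

Degree≤-resp-≗ : ∀ {d φ ψ} → φ ≗ ψ → Degree≤ d φ → Degree≤ d ψ
Degree≤-resp-≗ e (vanishes D) = vanishes λ β → trans (sym (e β)) (D β)
Degree≤-resp-≗ e (derived D)  = derived λ γ → Degree≤-resp-≗
  (λ β → cong₂ _-_ (cong₂ _-_ (e (γ ++ β)) (e γ)) (e β)) (D γ)

Degree≤-suc : ∀ {d φ} → Degree≤ d φ → Degree≤ (suc d) φ
Degree≤-suc (vanishes D) = derived λ γ → vanishes λ β →
  cong₂ _-_ (cong₂ _-_ (D (γ ++ β)) (D γ)) (D β)
Degree≤-suc (derived D)  = derived λ γ → Degree≤-suc (D γ)

Degree≤-mono : ∀ {d e φ} → d ≤ e → Degree≤ d φ → Degree≤ e φ
Degree≤-mono {d} {φ = φ} d≤e = go (ℕₚ.≤⇒≤′ d≤e)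
  where
  go : ∀ {e} → d ℕ.≤′ e → Degree≤ d φ → Degree≤ e φ
  go ℕ.≤′-refl       D = D
  go (ℕ.≤′-step d≤e) D = Degree≤-suc (go d≤e D)

Degree≤-+ : ∀ {d φ ψ} → Degree≤ d φ → Degree≤ d ψ → Degree≤ d (λ β → φ β + ψ β)
Degree≤-+ (vanishes D) (vanishes E) = vanishes λ β → cong₂ _+_ (D β) (E β)
Degree≤-+ {φ = φ} {ψ} (derived D) (derived E) = derived λ γ → Degree≤-resp-≗
  (λ β → ring (φ (γ ++ β)) (φ γ) (φ β) (ψ (γ ++ β)) (ψ γ) (ψ β)) (Degree≤-+ (D γ) (E γ))
  where
  ring : ∀ a b c d e f → (a - b - c) + (d - e - f) ≡ (a + d) - (b + e) - (c + f)
  ring = solve-∀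

Degree≤-* : ∀ {d φ} k → Degree≤ d φ → Degree≤ d (λ β → k * φ β)
Degree≤-* k (vanishes D) = vanishes λ β → trans (cong (k *_) (D β)) (ℤₚ.*-zeroʳ k)
Degree≤-* {φ = φ} k (derived D) = derived λ γ → Degree≤-resp-≗
  (λ β → ring k (φ (γ ++ β)) (φ γ) (φ β)) (Degree≤-* k (D γ))
  where
  ring : ∀ k a b c → k * (a - b - c) ≡ k * a - k * b - k * c
  ring = solve-∀

Degree≤-- : ∀ {d φ ψ} → Degree≤ d φ → Degree≤ d ψ → Degree≤ d (λ β → φ β - ψ β)
Degree≤-- {φ = φ} {ψ} D E = Degree≤-resp-≗
  (λ β → cong (λ z → φ β + z) (ℤₚ.-1*i≡-i (ψ β))) (Degree≤-+ D (Degree≤-* (- + 1) E))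

-- `∂ [] φ` takes the value `- φ []` at `[]`, so the claim descends to degree 0.
Degree≤-[] : ∀ {d φ} → Degree≤ d φ → φ [] ≡ + 0
Degree≤-[]         (vanishes D) = D []
Degree≤-[] {φ = φ} (derived D)  = ℤₚ.neg-injective (trans (sym (ring (φ []))) (Degree≤-[] (D [])))
  where
  ring : ∀ a → a - a - a ≡ - a
  ring = solve-∀

Additive : (List ℕ⁺ → ℤ) → Set
Additive n = ∀ γ β → n (γ ++ β) ≡ n γ + n β

Degree≤-additive : ∀ {n} → Additive n → Degree≤ 1 n
Degree≤-additive {n} n-+ = derived λ γ → vanishes λ β →
  trans (cong (λ z → z - n γ - n β) (n-+ γ β)) (ring (n γ) (n β))
  where
  ring : ∀ a b → (a + b) - a - b ≡ + 0
  ring = solve-∀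

-- Product rule: the derivative is n(γ) φ + n(γ) ∂φ + φ(γ) n + n ∂φ, with ∂φ = `∂ γ φ`. The last
-- product falls under the induction hypothesis, the degree bound of ∂φ being smaller.
Degree≤-additive-* : ∀ {d n φ} → Additive n → Degree≤ d φ → Degree≤ (suc d) (λ β → n β * φ β)
Degree≤-additive-* {n = n} n-+ (vanishes D) = Degree≤-suc (vanishes λ β →
  trans (cong (n β *_) (D β)) (ℤₚ.*-zeroʳ (n β)))
Degree≤-additive-* {n = n} {φ} n-+ (derived D) = derived λ γ → Degree≤-resp-≗ (expand γ)
  (Degree≤-+ (Degree≤-+ (Degree≤-* (n γ) (derived D)) (Degree≤-suc (Degree≤-* (n γ) (D γ))))
             (Degree≤-+ (Degree≤-mono (s≤s z≤n) (Degree≤-* (φ γ) (Degree≤-additive {n} n-+)))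
                        (Degree≤-additive-* {n = n} n-+ (D γ))))
  where
  ring : ∀ nγ nβ x a b → (nγ * b + nγ * (x - a - b)) + (a * nβ + nβ * (x - a - b))
                       ≡ (nγ + nβ) * x - nγ * a - nβ * b
  ring = solve-∀

  expand : ∀ γ β → (n γ * φ β + n γ * ∂ γ φ β) + (φ γ * n β + n β * ∂ γ φ β)
                 ≡ ∂ γ (λ β → n β * φ β) β
  expand γ β = trans (ring (n γ) (n β) (φ (γ ++ β)) (φ γ) (φ β))
    (cong (λ z → z * φ (γ ++ β) - n γ * φ γ - n β * φ β) (sym (n-+ γ β)))

-- Horner's scheme: each coefficient costs one multiplication by the additive `n`, which raises the
-- degree by one.
Degree≤-eval : ∀ P {n} → Additive n → Degree≤ (length P) (λ β → eval P (n β))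
Degree≤-eval []           n-+ = vanishes λ _ → refl
Degree≤-eval (c ∷ cs) {n} n-+ = Degree≤-resp-≗ (λ β → ring c (n β) (eval cs (n β)))
  (Degree≤-+ (Degree≤-mono (s≤s z≤n) (Degree≤-* c (Degree≤-additive {n} n-+)))
             (Degree≤-additive-* {n = n} n-+ (Degree≤-eval cs {n} n-+)))
  where
  ring : ∀ c x r → c * x + x * r ≡ x * (c + r)
  ring = solve-∀

-- The IP polynomial van der Waerden theorem

∈⇒≤sum : ∀ {X : Set} (f : X → ℕ) {x xs} → x ∈ˡ xs → f x ≤ sum (map f xs)
∈⇒≤sum f (here refl)  = ℕₚ.m≤m+n _ _
∈⇒≤sum f (there x∈xs) = ℕₚ.≤-trans (∈⇒≤sum f x∈xs) (ℕₚ.m≤n+m _ _)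

module PolynomialVanDerWaerden (em : ∀ {ℓ} → ExcludedMiddle ℓ) where

  -- The bound `M` lets a later block be appended to earlier ones with the entries still increasing.
  Beyond : ℕ → List ℕ⁺ → Set
  Beyond M β = β ≢ [] × AllPairs (_<_ on toℕ) β × All (λ t → M < toℕ t) β

  Monochromatic : ∀ {r} → (ℤ → Fin r) → List (List ℕ⁺ → ℤ) → ℤ → List ℕ⁺ → Set
  Monochromatic χ Φ a β = ∀ {φ} → φ ∈ˡ Φ → χ (a + φ β) ≡ χ a

  -- Finitely many configurations serve all colourings, so that patterns on finite blocks of points
  -- can be used as colours.
  Recurrent : List (List ℕ⁺ → ℤ) → Set
  Recurrent Φ = ∀ r M → Σ[ Cs ∈ List (ℤ × List ℕ⁺) ] (∀ (χ : ℤ → Fin r) →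
    ∃[ a ] ∃[ β ] ((a , β) ∈ˡ Cs × Beyond M β × Monochromatic χ Φ a β))

  private
    HitBy : ∀ {r} → (ℤ → Fin r) → List (List ℕ⁺ → ℤ) → ℕ → ℤ → List ℕ⁺ → Set
    HitBy χ Φ M a β = Beyond M β × Monochromatic χ Φ a β

    -- The spokes a + φ(β), φ ∈ Φ, of each β in βs have one colour, and these colours are distinct.
    record Focused {r} (χ : ℤ → Fin r) (Φ : List (List ℕ⁺ → ℤ)) (M s : ℕ)
                   (a : ℤ) (βs : List (List ℕ⁺)) : Set where
      field
        colours  : List (Fin r)
        number   : length colours ≡ s
        distinct : Unique colours
        beyond   : All (Beyond M) βs
        focused  : Pointwise (λ β c → ∀ {φ} → φ ∈ˡ Φ → χ (a + φ β) ≡ c) βs colours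

    open Focused

    Focusing : List (List ℕ⁺ → ℤ) → ℕ → ℕ → ℕ → Set
    Focusing Φ r M s = Σ[ Cs ∈ List (ℤ × List (List ℕ⁺)) ] (∀ (χ : ℤ → Fin r) →
      ∃[ a ] ∃[ βs ] ((a , βs) ∈ˡ Cs × (Any (HitBy χ Φ M a) βs ⊎ Focused χ Φ M s a βs)))

    shift : (List ℕ⁺ → ℤ) → List ℕ⁺ → (List ℕ⁺ → ℤ) → (List ℕ⁺ → ℤ)
    shift ψ γ φ β = φ (γ ++ β) - φ γ - ψ β

    shifts : (List ℕ⁺ → ℤ) → List (List ℕ⁺) → List (List ℕ⁺ → ℤ) → List (List ℕ⁺ → ℤ)
    shifts ψ = cartesianProductWith (shift ψ)

    hits-focused : ∀ {r} (χ : ℤ → Fin r) a {Φ M βs cs} → All (Beyond M) βs →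
      Pointwise (λ β c → ∀ {φ} → φ ∈ˡ Φ → χ (a + φ β) ≡ c) βs cs →
      Any (χ a ≡_) cs → Any (HitBy χ Φ M a) βs
    hits-focused χ a (bey ∷ _) (f ∷ _)  (here eq)  = here (bey , λ φ∈ → trans (f φ∈) (sym eq))
    hits-focused χ a (_ ∷ bey) (_ ∷ fs) (there eq) = there (hits-focused χ a bey fs eq)

    -- Colour focusing.  If the blocks b + [points] and b + shift ψ γ φ β + [points] look alike, then
    -- the focus moves from b + a to b + a - ψ(β), each γ in βs becomes γ ++ β, and β itself is a new
    -- spoke, of the colour of the old focus.
    fan-suc : ∀ {Φ ψ r M s} → (∀ {φ} → φ ∈ˡ Φ → φ [] ≡ + 0) →
      (∀ Γ → Recurrent (shifts ψ Γ Φ)) → Focusing Φ r M s → Focusing Φ r M (suc s)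
    fan-suc {Φ} {ψ} {r} {M} {s} φ[]≡0 recurrent (Cs , fan) =
      cartesianProductWith refocus Ds Cs ++ cartesianProductWith stay Ds Cs , found
      where
      -- The empty list contributes the differences `φ β - ψ β`, which compare the ends of the new
      -- spoke `β` with the old focus.
      Γ : List (List ℕ⁺)
      Γ = [] ∷ concatMap proj₂ Cs

      values : ℤ × List (List ℕ⁺) → List ℤ
      values (a , βs) = a ∷ cartesianProductWith (λ β φ → a + φ β) βs Φ

      points : List ℤ
      points = concatMap values Cs

      blockColour : (ℤ → Fin r) → ℤ → Fin (r ℕ.^ length points)
      blockColour χ b = funToFin (λ i → χ (b + lookup points i))

      -- The sum of all entries occurring in `Γ` dominates each of them, so `β` lies beyond every
      -- `γ` to which it is appended.
      bound : ℕ
      bound = M ℕ.+ sum (map toℕ (concat Γ))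

      Ds : List (ℤ × List ℕ⁺)
      Ds = proj₁ (recurrent Γ (r ℕ.^ length points) bound)

      refocus stay : ℤ × List ℕ⁺ → ℤ × List (List ℕ⁺) → ℤ × List (List ℕ⁺)
      refocus (b , β) (a , βs) = b + a - ψ β , β ∷ map (_++ β) βs
      stay    (b , β) (a , βs) = b + a , βs

      found : (χ : ℤ → Fin r) → ∃[ a ] ∃[ βs ]
        ((a , βs) ∈ˡ cartesianProductWith refocus Ds Cs ++ cartesianProductWith stay Ds Cs ×
         (Any (HitBy χ Φ M a) βs ⊎ Focused χ Φ M (suc s) a βs))
      found χ with proj₂ (recurrent Γ (r ℕ.^ length points) bound) (blockColour χ)
      ... | b , β , bβ∈ , (β≢[] , inc , big) , mono with fan (λ x → χ (b + x))
      ...   | a , βs , aβs∈ , outcome = conclude outcome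
        where
        β-beyond : Beyond M β
        β-beyond = β≢[] , inc , All.map (ℕₚ.≤-<-trans (ℕₚ.m≤m+n M _)) big

        unchanged : ∀ {γ φ x} → γ ∈ˡ Γ → φ ∈ˡ Φ → x ∈ˡ points →
          χ (b + shift ψ γ φ β + x) ≡ χ (b + x)
        unchanged {γ} {φ} {x} γ∈ φ∈ x∈ =
          subst (λ y → χ (b + shift ψ γ φ β + y) ≡ χ (b + y)) (sym (Anyₚ.lookup-index x∈))
            (trans (sym (Finₚ.finToFun-funToFin
                          (λ i → χ (b + shift ψ γ φ β + lookup points i)) (index x∈)))
            (trans (cong (λ c → finToFun c (index x∈)) (mono (∈-cartesianProductWith⁺ (shift ψ) γ∈ φ∈)))
                   (Finₚ.finToFun-funToFin (λ i → χ (b + lookup points i)) (index x∈))))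

        values⊆points : ∀ {x} → x ∈ˡ values (a , βs) → x ∈ˡ points
        values⊆points x∈ = ∈-concatMap⁺ values (Any.map (λ { refl → x∈ }) aβs∈)

        βs⊆Γ : ∀ {γ} → γ ∈ˡ βs → γ ∈ˡ Γ
        βs⊆Γ γ∈ = there (∈-concatMap⁺ proj₂ (Any.map (λ { refl → γ∈ }) aβs∈))

        old : Any (HitBy (λ x → χ (b + x)) Φ M a) βs → _
        old hit = b + a , βs ,
          ∈-++⁺ʳ (cartesianProductWith refocus Ds Cs) (∈-cartesianProductWith⁺ stay bβ∈ aβs∈) ,
          inj₁ (Any.map (λ { {β′} (bey , m) → bey , λ {φ} φ∈ →
            trans (cong χ (ℤₚ.+-assoc b a (φ β′))) (m φ∈) }) hit)

        beyond-++ : ∀ {γ} → γ ∈ˡ βs → Beyond M γ → Beyond M (γ ++ β)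
        beyond-++ {γ} γ∈ (γ≢[] , inc′ , big′) =
          γ++β≢[] γ γ≢[] ,
          AllPairsₚ.++⁺ inc′ inc (All.tabulate λ t∈ → All.map (ℕₚ.≤-<-trans
            (ℕₚ.≤-trans (∈⇒≤sum toℕ (∈-concat⁺′ t∈ (βs⊆Γ γ∈))) (ℕₚ.m≤n+m _ M))) big) ,
          Allₚ.++⁺ big′ (proj₂ (proj₂ β-beyond))
          where
          γ++β≢[] : ∀ γ → γ ≢ [] → γ ++ β ≢ []
          γ++β≢[] []      γ≢[] = ⊥-elim (γ≢[] refl)
          γ++β≢[] (_ ∷ _) _    = λ ()

        beyonds : ∀ {δs} → (∀ {γ} → γ ∈ˡ δs → γ ∈ˡ βs) → All (Beyond M) δs →
          All (Beyond M) (map (_++ β) δs)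
        beyonds δs⊆βs []          = []
        beyonds δs⊆βs (bey ∷ bys) = beyond-++ (δs⊆βs (here refl)) bey ∷ beyonds (δs⊆βs ∘ there) bys

        ring-old : ∀ b a ψβ φγβ φγ → b + a - ψβ + φγβ ≡ b + (φγβ - φγ - ψβ) + (a + φγ)
        ring-old = solve-∀

        ring-new : ∀ b a ψβ φβ → b + a - ψβ + φβ ≡ b + (φβ - + 0 - ψβ) + a
        ring-new = solve-∀

        focuses : ∀ {δs cs} → (∀ {γ} → γ ∈ˡ δs → γ ∈ˡ βs) →
          Pointwise (λ δ c → ∀ {φ} → φ ∈ˡ Φ → χ (b + (a + φ δ)) ≡ c) δs cs →
          Pointwise (λ δ c → ∀ {φ} → φ ∈ˡ Φ → χ (b + a - ψ β + φ δ) ≡ c) (map (_++ β) δs) cs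
        focuses δs⊆βs []       = []
        focuses {δ ∷ _} δs⊆βs (f ∷ fs) =
          (λ {φ} φ∈ → trans (cong χ (ring-old b a (ψ β) (φ (δ ++ β)) (φ δ)))
            (trans (unchanged (βs⊆Γ (δs⊆βs (here refl))) φ∈
                     (values⊆points (there
                       (∈-cartesianProductWith⁺ (λ β φ → a + φ β) (δs⊆βs (here refl)) φ∈))))
                   (f φ∈)))
          ∷ focuses (δs⊆βs ∘ there) fs

        conclude : Any (HitBy (λ x → χ (b + x)) Φ M a) βs ⊎
                   Focused (λ x → χ (b + x)) Φ M s a βs → _
        conclude (inj₁ hit) = old hit
        -- If the old focus already has the colour of a spoke, that spoke is a hit. Otherwise its
        -- colour is new and can be added to the distinct ones.
        conclude (inj₂ foc) with Any.any? (χ (b + a) Finₚ.≟_) (colours foc)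
        ... | yes c∈ = old (hits-focused (λ x → χ (b + x)) a (beyond foc) (focused foc) c∈)
        ... | no  c∉ = b + a - ψ β , β ∷ map (_++ β) βs ,
          ∈-++⁺ˡ (∈-cartesianProductWith⁺ refocus bβ∈ aβs∈) , inj₂ record
            { colours  = χ (b + a) ∷ colours foc
            ; number   = cong suc (number foc)
            ; distinct = Allₚ.¬Any⇒All¬ _ c∉ ∷ distinct foc
            ; beyond   = β-beyond ∷ beyonds id (beyond foc)
            ; focused  = (λ {φ} φ∈ → trans
                (cong χ (trans (ring-new b a (ψ β) (φ β))
                  (cong (λ z → b + (φ β - z - ψ β) + a) (sym (φ[]≡0 φ∈)))))
                (unchanged (here refl) φ∈ (values⊆points (here refl))))
              ∷ focuses id (focused foc)
            }

    lookup-distinct : ∀ {r} {cs : List (Fin r)} → Unique cs →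
      ∀ {i j} → i Fin.< j → lookup cs i ≢ lookup cs j
    lookup-distinct (c∉ ∷ _) {Fin.zero}  {Fin.suc j} _ = All.lookup c∉ (∈-lookup j)
    lookup-distinct (_ ∷ cs) {Fin.suc i} {Fin.suc j} (s≤s i<j) = lookup-distinct cs i<j

    -- More than r distinct colours cannot be focused, so a fan with r + 1 spokes is monochromatic.
    recurrent-step : ∀ {Φ ψ} → (∀ {φ} → φ ∈ˡ Φ → φ [] ≡ + 0) →
      (∀ Γ → Recurrent (shifts ψ Γ Φ)) → Recurrent Φ
    recurrent-step {Φ} φ[]≡0 recurrent r M = concatMap spokes (proj₁ (fan (suc r))) , hit
      where
      fan : ∀ s → Focusing Φ r M s
      fan zero    = (+ 0 , []) ∷ [] , λ χ → + 0 , [] , here refl , inj₂ record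
        { colours = [] ; number = refl ; distinct = [] ; beyond = [] ; focused = [] }
      fan (suc s) = fan-suc φ[]≡0 recurrent (fan s)

      spokes : ℤ × List (List ℕ⁺) → List (ℤ × List ℕ⁺)
      spokes (a , βs) = map (a ,_) βs

      hit : (χ : ℤ → Fin r) → ∃[ a ] ∃[ β ]
        ((a , β) ∈ˡ concatMap spokes (proj₁ (fan (suc r))) × Beyond M β × Monochromatic χ Φ a β)
      hit χ with proj₂ (fan (suc r)) χ
      ... | a , βs , aβs∈ , inj₁ h with find h
      ...   | β , β∈ , bey , mono =
        a , β , ∈-concatMap⁺ spokes (Any.map (λ { refl → ∈-map⁺ (a ,_) β∈ }) aβs∈) , bey , mono
      hit χ | a , βs , aβs∈ , inj₂ foc
        with Finₚ.pigeonhole (ℕₚ.≤-reflexive (sym (number foc))) (lookup (colours foc))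
      ... | i , j , i<j , eq = ⊥-elim (lookup-distinct (distinct foc) i<j eq)

    -- (e , ψ) represents the functions whose difference from ψ has degree at most e; the weight of
    -- a finite family in PET induction is the multiset of the levels e of its representatives.
    Representative : Set
    Representative = ℕ × (List ℕ⁺ → ℤ)

    Valid : Representative → Set
    Valid (e , ψ) = Degree≤ (suc e) ψ

    Represents : (List ℕ⁺ → ℤ) → Representative → Set
    Represents φ (e , ψ) = Degree≤ e (λ β → φ β - ψ β)

    Covered : List Representative → (List ℕ⁺ → ℤ) → Set
    Covered R φ = Degree≤ 0 φ ⊎ Any (Represents φ) R

    RecurrentAt : List ℕ → Set
    RecurrentAt es = ∀ {R} → map proj₁ R ≡ es → All Valid R →
      ∀ {Φ} → (∀ {φ} → φ ∈ˡ Φ → Covered R φ) → Recurrent Φ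

    lowerBy : (List ℕ⁺ → ℤ) → Representative → Representative
    lowerBy ψ (e , ψ′) = e , λ β → ψ′ β - ψ β

    -- Below level 0 nothing is created: a function of degree at most 0 is zero, and `Covered`
    -- admits it without a representative.
    below : ℕ → ℕ → List ℕ
    below zero    k = []
    below (suc e) k = replicate k e

    shift-difference : ∀ (ψ ψ′ : List ℕ⁺ → ℤ) γ φ β →
      (φ β - ψ′ β) + ∂ γ φ β ≡ shift ψ γ φ β - (ψ′ β - ψ β)
    shift-difference ψ ψ′ γ φ β = ring (φ β) (ψ′ β) (ψ β) (φ (γ ++ β)) (φ γ)
      where
      ring : ∀ φβ ψ′β ψβ φγβ φγ → (φβ - ψ′β) + (φγβ - φγ - φβ) ≡ (φγβ - φγ - ψβ) - (ψ′β - ψβ)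
      ring = solve-∀

    represented-degree : ∀ {φ ψ e} → Degree≤ (suc e) ψ → Degree≤ e (λ β → φ β - ψ β) →
      Degree≤ (suc e) φ
    represented-degree {φ} {ψ} D E = Degree≤-resp-≗
      (λ β → ring (φ β) (ψ β)) (Degree≤-+ (Degree≤-suc E) D)
      where
      ring : ∀ a b → (a - b) + b ≡ a
      ring = solve-∀

    ∂-degree : ∀ {d φ} γ → Degree≤ (suc d) φ → Degree≤ d (∂ γ φ)
    ∂-degree γ (derived D) = D γ

    -- Shifting turns the representative `ψ′` into `ψ′ - ψ`: the error is `(φ - ψ′) + ∂ γ φ`, and
    -- both summands have degree at most `e`.
    shift-represented : ∀ {ψ ψ′ φ e} γ → Degree≤ (suc e) ψ′ → Degree≤ e (λ β → φ β - ψ′ β) →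
      Degree≤ e (λ β → shift ψ γ φ β - (ψ′ β - ψ β))
    shift-represented {ψ} {ψ′} {φ} γ D E = Degree≤-resp-≗ (shift-difference ψ ψ′ γ φ)
      (Degree≤-+ E (∂-degree γ (represented-degree {φ} {ψ′} D E)))

    -- PET induction: passing to shifts removes a representative of least level e and creates
    -- representatives of level less than e only.
    recurrent-∷ : ∀ e {es} → All (e ≤_) es →
      (∀ k → RecurrentAt (below e k ++ es)) → RecurrentAt (e ∷ es)
    recurrent-∷ e {es} e≤es lower {(_ , ψ) ∷ R} refl (Dψ ∷ valid) {Φ} covered r M =
      proj₁ rec , λ χ → let (a , β , aβ∈ , bey , mono) = proj₂ rec χ in
        a , β , aβ∈ , bey , λ {φ} φ∈ → extend χ φ∈ mono
      where
      nonzero? : ∀ φ → Dec (¬ Degree≤ 0 φ)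
      nonzero? φ = ¬? em

      -- The shifts of the zero function contain -ψ, which would keep the weight from decreasing.
      Φ⁺ : List (List ℕ⁺ → ℤ)
      Φ⁺ = filter nonzero? Φ

      covered⁺ : ∀ {φ} → φ ∈ˡ Φ⁺ → Any (Represents φ) ((e , ψ) ∷ R)
      covered⁺ φ∈ with ∈-filter⁻ nonzero? {xs = Φ} φ∈
      ... | φ∈Φ , nz with covered φ∈Φ
      ...   | inj₁ z = ⊥-elim (nz z)
      ...   | inj₂ c = c

      φ[]≡0 : ∀ {φ} → φ ∈ˡ Φ⁺ → φ [] ≡ + 0
      φ[]≡0 {φ} φ∈ = go φ (Dψ ∷ valid) (covered⁺ φ∈)
        where
        go : ∀ {R} φ → All Valid R → Any (Represents φ) R → φ [] ≡ + 0
        go {(e , ψ) ∷ _} φ (D ∷ _)     (here c)  = Degree≤-[] (represented-degree {φ} {ψ} D c)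
        go               φ (_ ∷ valid) (there c) = go φ valid c

      lowered : List Representative
      lowered = map (lowerBy ψ) R

      lowered-levels : ∀ R → map proj₁ (map (lowerBy ψ) R) ≡ map proj₁ R
      lowered-levels []      = refl
      lowered-levels (_ ∷ R) = cong (_ ∷_) (lowered-levels R)

      -- Minimality of `e` enters here: subtracting `ψ`, of degree at most `suc e`, does not spoil
      -- the bound for a representative of level at least `e`.
      lowered-valid : ∀ {R} → All (e ≤_) (map proj₁ R) → All Valid R →
        All Valid (map (lowerBy ψ) R)
      lowered-valid {[]}    []           []      = []
      lowered-valid {_ ∷ _} (e≤e′ ∷ e≤R) (D ∷ v) =
        Degree≤-- D (Degree≤-mono (s≤s e≤e′) Dψ) ∷ lowered-valid e≤R v

      lowered-represents : ∀ {R} φ γ → All Valid R → Any (Represents φ) R →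
        Any (Represents (shift ψ γ φ)) (map (lowerBy ψ) R)
      lowered-represents {(_ , ψ′) ∷ _} φ γ (D ∷ _) (here c)  =
        here (shift-represented {ψ} {ψ′} {φ} γ D c)
      lowered-represents φ γ (_ ∷ v) (there c) = there (lowered-represents φ γ v c)

      small? : ∀ φ → Dec (Degree≤ e φ)
      small? φ = em

      -- Shifts of functions represented by `ψ` itself have degree at most `e`; each becomes its own
      -- representative one level down.
      fresh : ∀ e → List (List ℕ⁺ → ℤ) → List Representative
      fresh zero    Ψ = []
      fresh (suc e) Ψ = map (e ,_) Ψ

      fresh-levels : ∀ e Ψ → map proj₁ (fresh e Ψ) ≡ below e (length Ψ)
      fresh-levels zero    Ψ       = refl
      fresh-levels (suc e) []      = refl
      fresh-levels (suc e) (_ ∷ Ψ) = cong (e ∷_) (fresh-levels (suc e) Ψ)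

      fresh-valid : ∀ e {Ψ} → All (Degree≤ e) Ψ → All Valid (fresh e Ψ)
      fresh-valid zero    _       = []
      fresh-valid (suc e) []      = []
      fresh-valid (suc e) (D ∷ v) = D ∷ fresh-valid (suc e) v

      fresh-covered : ∀ e {Ψ φ} → φ ∈ˡ Ψ → Degree≤ e φ → Covered (fresh e Ψ) φ
      fresh-covered zero            φ∈ D = inj₁ D
      fresh-covered (suc e) {φ = φ} φ∈ D = inj₂ (Any.map (λ { refl →
        Degree≤-mono z≤n (vanishes λ β → ℤₚ.+-inverseʳ (φ β)) }) (∈-map⁺ (e ,_) φ∈))

      recurrent-shifts : ∀ Γ → Recurrent (shifts ψ Γ Φ⁺)
      recurrent-shifts Γ = lower (length small) {fresh e small ++ lowered} levels
        (Allₚ.++⁺ (fresh-valid e (Allₚ.all-filter small? (shifts ψ Γ Φ⁺))) (lowered-valid e≤es valid))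
        cover
        where
        small : List (List ℕ⁺ → ℤ)
        small = filter small? (shifts ψ Γ Φ⁺)

        levels : map proj₁ (fresh e small ++ lowered) ≡ below e (length small) ++ es
        levels = trans (map-++ proj₁ (fresh e small) lowered)
          (cong₂ _++_ (fresh-levels e small) (lowered-levels R))

        cover : ∀ {φ} → φ ∈ˡ shifts ψ Γ Φ⁺ → Covered (fresh e small ++ lowered) φ
        cover φ∈ with ∈-cartesianProductWith⁻ (shift ψ) Γ Φ⁺ φ∈
        ... | γ , φ , γ∈ , φ∈⁺ , refl with covered⁺ φ∈⁺
        ...   | there c = inj₂ (Anyₚ.++⁺ʳ (fresh e small) (lowered-represents φ γ valid c))
        ...   | here c = Sum.map₂ Anyₚ.++⁺ˡ (fresh-covered e (∈-filter⁺ small? φ∈ D) D)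
          where
          ring : ∀ a b → a - (b - b) ≡ a
          ring = solve-∀

          D : Degree≤ e (shift ψ γ φ)
          D = Degree≤-resp-≗ (λ β → ring (shift ψ γ φ β) (ψ β))
                (shift-represented {ψ} {ψ} {φ} γ Dψ c)

      rec : Σ[ Cs ∈ List (ℤ × List ℕ⁺) ] (∀ (χ : ℤ → Fin r) →
        ∃[ a ] ∃[ β ] ((a , β) ∈ˡ Cs × Beyond M β × Monochromatic χ Φ⁺ a β))
      rec = recurrent-step φ[]≡0 recurrent-shifts r M

      extend : ∀ (χ : ℤ → Fin r) {a β φ} → φ ∈ˡ Φ → Monochromatic χ Φ⁺ a β → χ (a + φ β) ≡ χ a
      extend χ {a} {β} {φ} φ∈ mono with em {P = Degree≤ 0 φ}
      ... | yes (vanishes z) = cong χ (trans (cong (λ y → a + y) (z β)) (ℤₚ.+-identityʳ a))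
      ... | no nz = mono (∈-filter⁺ nonzero? φ∈ nz)

    recurrent-[] : RecurrentAt []
    recurrent-[] {[]} refl [] covered r M = (+ 0 , β) ∷ [] , λ χ →
      + 0 , β , here refl , ((λ ()) , [] ∷ [] , ℕₚ.≤-refl ∷ []) , mono χ
      where
      -- The entry is the integer M + 1, the least one beyond `M`. Any block would do, as only zero
      -- functions are covered.
      β : List ℕ⁺
      β = (1+ M) ∷ []

      mono : (χ : ℤ → Fin r) → Monochromatic χ _ (+ 0) β
      mono χ φ∈ with covered φ∈
      ... | inj₁ (vanishes z) = cong χ (trans (cong (λ y → + 0 + y) (z β)) refl)

    -- The multiset order on weights is unrolled into structural recursion: outer induction on `e`,
    -- inner induction on the number `k` of entries one level lower.
    recurrent-cons : ∀ e {es} → All (e ≤_) es → RecurrentAt es → RecurrentAt (e ∷ es)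
    recurrent-cons zero    e≤es rec = recurrent-∷ zero e≤es λ _ → rec
    recurrent-cons (suc e) {es} e≤es rec = recurrent-∷ (suc e) e≤es go
      where
      go : ∀ k → RecurrentAt (replicate k e ++ es)
      go zero    = rec
      go (suc k) = recurrent-cons e
        (Allₚ.++⁺ (Allₚ.replicate⁺ k ℕₚ.≤-refl) (All.map ℕₚ.<⇒≤ e≤es)) (go k)

  -- Every function serves as its own representative at level `d`.
  polynomial-van-der-Waerden : ∀ d {Φ} → All (Degree≤ d) Φ → Recurrent Φ
  polynomial-van-der-Waerden d {Φ} D = levels (length Φ) {map (d ,_) Φ} (map-proj₁ Φ)
    (Allₚ.map⁺ (All.map Degree≤-suc D))
    λ {φ} φ∈ → inj₂ (Any.map (λ { refl →
      Degree≤-mono z≤n (vanishes λ β → ℤₚ.+-inverseʳ (φ β)) }) (∈-map⁺ (d ,_) φ∈))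
    where
    levels : ∀ k → RecurrentAt (replicate k d)
    levels zero    = recurrent-[]
    levels (suc k) = recurrent-cons d (Allₚ.replicate⁺ k ℕₚ.≤-refl) (levels k)

    map-proj₁ : ∀ Φ → map proj₁ (map (d ,_) Φ) ≡ replicate (length Φ) d
    map-proj₁ []      = refl
    map-proj₁ (_ ∷ Φ) = cong (d ∷_) (map-proj₁ Φ)

-- Zorn's lemma and the ultrafilter lemma

module Classical (em : ∀ {ℓ} → ExcludedMiddle ℓ) (ext : ∀ {a b} → Extensionality a b) where

  T-antisym : ∀ {a b} → (T a → T b) → (T b → T a) → a ≡ b
  T-antisym {true}  {true}  _ _ = refl
  T-antisym {true}  {false} f _ = ⊥-elim (f tt)
  T-antisym {false} {true}  _ g = ⊥-elim (g tt)
  T-antisym {false} {false} _ _ = refl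

  module Zorn {X : Set} (Good : (X → Bool) → Set) where

    -- Boolean values keep families in `Set`, so that unions range over all of them, and make
    -- mutually included families equal by extensionality.
    Family : Set
    Family = X → Bool

    infix 4 _⊑_

    _⊑_ : Family → Family → Set
    F ⊑ G = ∀ x → T (F x) → T (G x)

    insert : X → Family → Family
    insert x F y = ⌊ em {P = y ≡ x ⊎ T (F y)} ⌋

    ⋃ : (Family → Bool) → Family
    ⋃ S x = ⌊ em {P = ∃[ F ] (T (S F) × T (F x))} ⌋

    Extension : Family → Set
    Extension F = ∃[ x ] (¬ T (F x) × Good (insert x F))

    next : Family → Family
    next F with em {P = Extension F}
    ... | yes (x , _) = insert x F
    ... | no  _       = F

    ⊑-next : ∀ {F} → F ⊑ next F
    ⊑-next {F} y y∈ with em {P = Extension F}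
    ... | yes (x , _) = fromWitness (inj₂ y∈)
    ... | no  _       = y∈

    -- The least collection of families closed under next and unions; comparing its members
    -- pairwise shows that it is a chain (Zermelo), so that its union is maximal.
    data Tower : Family → Set where
      step : ∀ {F} → Tower F → Tower (next F)
      join : ∀ {S} → (∀ F → T (S F) → Tower F) → Tower (⋃ S)

    -- For a union, either some member contains `next G` or all lie in `G`. For `next F` with
    -- `F ⊑ G`, the reverse comparison gives `next F ⊑ G` or `G ⊑ F`; in the latter case `F` and `G`
    -- are equal.
    compare : ∀ {F G} → Tower F → Tower G → F ⊑ G ⊎ next G ⊑ F
    compare {G = G} (join {S} t) g with em {P = ∃[ F ] (T (S F) × next G ⊑ F)}
    ... | yes (F , s , G⊑F) = inj₂ λ x x∈ → fromWitness (F , s , G⊑F x x∈)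
    ... | no  none          = inj₁ λ x x∈ → below x (toWitness x∈)
      where
      below : ∀ x → ∃[ F ] (T (S F) × T (F x)) → T (G x)
      below x (F , s , x∈) with compare (t F s) g
      ... | inj₁ F⊑G = F⊑G x x∈
      ... | inj₂ G⊑F = ⊥-elim (none (F , s , G⊑F))
    compare (step {F} f) g with compare f g
    ... | inj₂ G⊑F = inj₂ λ x x∈ → ⊑-next {F} x (G⊑F x x∈)
    ... | inj₁ F⊑G with compare g f
    ...   | inj₂ F⊑G′ = inj₁ F⊑G′
    ...   | inj₁ G⊑F  = inj₂ λ x → subst (λ H → T (next H x)) (ext λ y → T-antisym (G⊑F y) (F⊑G y))

    tower-total : ∀ {F G} → Tower F → Tower G → F ⊑ G ⊎ G ⊑ F
    tower-total {G = G} f g with compare f g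
    ... | inj₁ F⊑G = inj₁ F⊑G
    ... | inj₂ G⊑F = inj₂ λ x x∈ → G⊑F x (⊑-next {G} x x∈)

    module _ (good-⋃ : ∀ S → (∀ F G → T (S F) → T (S G) → F ⊑ G ⊎ G ⊑ F) →
                       (∀ F → T (S F) → Good F) → Good (⋃ S)) where

      tower-good : ∀ {F} → Tower F → Good F
      tower-good (join t) = good-⋃ _ (λ F G F∈ G∈ → tower-total (t F F∈) (t G G∈))
        (λ F F∈ → tower-good (t F F∈))
      tower-good (step {F} f) with em {P = Extension F}
      ... | yes (x , _ , good) = good
      ... | no  _              = tower-good f

      top : Family
      top = ⋃ λ F → ⌊ em {P = Tower F} ⌋

      top-tower : Tower top
      top-tower = join λ F → toWitness

      next-top : next top ⊑ top
      next-top x x∈ = fromWitness (next top , fromWitness (step top-tower) , x∈)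

      top-maximal : ∀ x → Good (insert x top) → T (top x)
      top-maximal x good with em {P = T (top x)}
      ... | yes x∈ = x∈
      ... | no  x∉ = ⊥-elim (absurd next-top)
        where
        absurd : ¬ (next top ⊑ top)
        absurd le with em {P = Extension top}
        ... | yes (y , y∉ , _) = y∉ (le y (fromWitness (inj₁ refl)))
        ... | no  none         = none (x , x∉ , good)

      maximal : ∃[ F ] (Good F × (∀ x → Good (insert x F) → T (F x)))
      maximal = top , tower-good top-tower , top-maximal

  module UltrafilterLemma {X : Set} (Small : Pred (Pred X 0ℓ) 0ℓ)
    (small-⊆ : ∀ {A B} → A ⊆ B → Small B → Small A)
    (small-∅ : Small ∅)
    (small-∪ : ∀ {A B} → Small A → Small B → Small (A ∪ B))
    (¬small-U : ¬ Small U) where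

    Meet : List (X → Bool) → Pred X 0ℓ
    Meet bs x = All (λ b → T (b x)) bs

    Good : ((X → Bool) → Bool) → Set
    Good F = ∀ bs → All (T ∘ F) bs → ¬ Small (Meet bs)

    open Zorn Good using (⋃; insert; maximal; _⊑_)

    good-⋃ : ∀ S → (∀ F G → T (S F) → T (S G) → F ⊑ G ⊎ G ⊑ F) →
             (∀ F → T (S F) → Good F) → Good (⋃ S)
    good-⋃ S chain good bs bs⊆ with one bs bs⊆
      where
      one : ∀ bs → All (T ∘ ⋃ S) bs → bs ≡ [] ⊎ ∃[ F ] (T (S F) × All (T ∘ F) bs)
      one []       []          = inj₁ refl
      one (b ∷ bs) (b∈ ∷ bs⊆) with toWitness b∈ | one bs bs⊆
      ... | F , F∈ , b∈F | inj₁ refl = inj₂ (F , F∈ , b∈F ∷ [])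
      ... | F , F∈ , b∈F | inj₂ (G , G∈ , bs∈G) with chain F G F∈ G∈
      ...   | inj₁ F⊑G = inj₂ (G , G∈ , F⊑G b b∈F ∷ bs∈G)
      ...   | inj₂ G⊑F = inj₂ (F , F∈ , b∈F ∷ All.map (λ {b} → G⊑F b) bs∈G)
    -- No member of the chain need be available here; the empty meet is the whole set.
    ... | inj₁ refl           = λ small → ¬small-U (small-⊆ (λ _ → []) small)
    ... | inj₂ (F , F∈ , bs∈) = good F F∈ bs bs∈

    F : (X → Bool) → Bool
    F = proj₁ (maximal good-⋃)

    F-good : Good F
    F-good = proj₁ (proj₂ (maximal good-⋃))

    char : Pred X 0ℓ → X → Bool
    char A x = ⌊ em {P = A x} ⌋

    -- By maximality, adjoining `A` creates a small finite meet; `bs` consists of its members other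
    -- than `A`.
    absent : ∀ {A} → ¬ T (F (char A)) → ∃[ bs ] (All (T ∘ F) bs × Small (Meet bs ∩ A))
    absent {A} A∉ with em {P = ∃[ bs ] (All (T ∘ F) bs × Small (Meet bs ∩ A))}
    ... | yes found = found
    ... | no  none  = ⊥-elim (A∉ (proj₂ (proj₂ (maximal good-⋃)) (char A) good))
      where
      split : ∀ cs → All (T ∘ insert (char A) F) cs →
        ∃[ bs ] (All (T ∘ F) bs × (∀ {x} → Meet bs x → A x → Meet cs x))
      split []       []         = [] , [] , λ _ _ → []
      split (c ∷ cs) (c∈ ∷ cs⊆) with toWitness c∈ | split cs cs⊆
      ... | inj₁ refl | bs , bs⊆ , sub = bs , bs⊆ , λ m a → fromWitness a ∷ sub m a
      ... | inj₂ c∈F  | bs , bs⊆ , sub = c ∷ bs , c∈F ∷ bs⊆ , λ { (t ∷ m) a → t ∷ sub m a }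

      good : Good (insert (char A) F)
      good cs cs⊆ small with split cs cs⊆
      ... | bs , bs⊆ , sub = none (bs , bs⊆ , small-⊆ (λ { (m , a) → sub m a }) small)

    present : ∀ {A} → (∀ bs → All (T ∘ F) bs → ¬ Small (Meet bs ∩ A)) → T (F (char A))
    present {A} large with em {P = T (F (char A))}
    ... | yes A∈ = A∈
    ... | no  A∉ with absent A∉
    ...   | bs , bs⊆ , small = ⊥-elim (large bs bs⊆ small)

    ultrafilter : Ultrafilter X
    ultrafilter = record
      { sets   = λ A → T (F (char A))
      ; whole  = present λ bs bs⊆ small → F-good bs bs⊆ (small-⊆ (λ m → m , tt) small)
      ; proper = λ ∅∈ → F-good (char ∅ ∷ []) (∅∈ ∷ []) (small-⊆ (λ { (t ∷ []) → toWitness t }) small-∅)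
      ; upward = λ {A} A⊆B A∈ → present λ bs bs⊆ small → F-good (char A ∷ bs) (A∈ ∷ bs⊆)
          (small-⊆ (λ { (t ∷ m) → m , A⊆B (toWitness t) }) small)
      ; inter  = λ {A} {B} A∈ B∈ → present λ bs bs⊆ small →
          F-good (char A ∷ char B ∷ bs) (A∈ ∷ B∈ ∷ bs⊆)
          (small-⊆ (λ { (s ∷ t ∷ m) → m , toWitness s , toWitness t }) small)
      ; ultra  = dichotomy
      }
      where
      -- If both `A` and its complement were absent, one finite meet would be covered by two small
      -- sets.
      dichotomy : ∀ A → T (F (char A)) ⊎ T (F (char (∁ A)))
      dichotomy A with em {P = T (F (char A))} | em {P = T (F (char (∁ A)))}
      ... | yes A∈ | _      = inj₁ A∈
      ... | no _   | yes A∈ = inj₂ A∈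
      ... | no A∉  | no ∁A∉ with absent A∉ | absent ∁A∉
      ...   | bs , bs⊆ , small | cs , cs⊆ , small′ =
        ⊥-elim (F-good (bs ++ cs) (Allₚ.++⁺ bs⊆ cs⊆) (small-⊆ cover (small-∪ small small′)))
        where
        cover : Meet (bs ++ cs) ⊆ ((Meet bs ∩ A) ∪ (Meet cs ∩ ∁ A))
        cover {x} m with em {P = A x}
        ... | yes a = inj₁ (Allₚ.++⁻ˡ bs m , a)
        ... | no ¬a = inj₂ (Allₚ.++⁻ʳ bs m , ¬a)

    avoids-small : ∀ {A} → A ∈ᵘ ultrafilter → ¬ Small A
    avoids-small {A} A∈ small = F-good (char A ∷ []) (A∈ ∷ [])
      (small-⊆ (λ { (t ∷ []) → toWitness t }) small)

-- Minimal ultrafilters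

∈ᵘ-inhabited : (∀ {ℓ} → ExcludedMiddle ℓ) → ∀ {X} (u : Ultrafilter X) {A} → A ∈ᵘ u → ∃ A
∈ᵘ-inhabited em u {A} A∈ with em {P = ∃ A}
... | yes a = a
... | no ¬a = ⊥-elim (proper u (upward u (λ {x} a → ¬a (x , a)) A∈))

⋂-∈ᵘ : ∀ {X Y : Set} (u : Ultrafilter Y) (xs : List X) {S : X → Pred Y 0ℓ} →
  (∀ {x} → x ∈ˡ xs → S x ∈ᵘ u) → (λ y → ∀ {x} → x ∈ˡ xs → S x y) ∈ᵘ u
⋂-∈ᵘ u []       S∈ = upward u (λ _ ()) (whole u)
⋂-∈ᵘ u (x ∷ xs) S∈ = upward u (λ { (s , ss) (here refl) → s ; (s , ss) (there x∈) → ss x∈ })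
  (inter u (S∈ (here refl)) (⋂-∈ᵘ u xs (S∈ ∘ there)))

-- Total, with arbitrary values off the positive integers, so that `finish` can be formed before
-- positivity is known.
toPositive : ℤ → ℕ⁺
toPositive z = 1+ ℕ.pred ∣ z ∣

toPositive-+ : ∀ {n z} → + toℕ n ≡ z → toPositive z ≡ n
toPositive-+ refl = refl

shift-positive : ∀ z s → ∣ z ∣ < s → + toℕ (toPositive (+ s + z)) ≡ + s + z
shift-positive (+ n)    (suc s) _     = refl
shift-positive -[1+ n ] (suc s) (s≤s n<s) = trans
  (cong (λ z → + toℕ (toPositive z)) eq)
  (trans (pos (ℕₚ.m<n⇒0<n∸m n<s)) (sym eq))
  where
  eq : + suc s + -[1+ n ] ≡ + (s ℕ.∸ n)
  eq = ℤₚ.⊖-≥ (ℕₚ.<⇒≤ (s≤s n<s))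

  pos : ∀ {k} → 0 < k → + toℕ (toPositive (+ k)) ≡ + k
  pos (s≤s _) = refl

Configuration : List⁺ ℙ → 𝒫fFun → Pred ℕ⁺ 0ℓ → ℕ⁺ → 𝒫fℕ → Set
Configuration F H A a β = ∀ P f → P ∈⁺ F → f ∈ᶠ H →
  + toℕ a + eval P (+ (∑[ t ∈ β ] toℕ (f t))) ∈ᶻ A

Hit : List⁺ ℙ → 𝒫fFun → Pred ℕ⁺ 0ℓ → Set
Hit F H A = ∃[ a ] ∃[ β ] Configuration F H A a β

∈ᶠ-representative : ∀ {f} H → f ∈ᶠ H → ∃[ g ] (g ∈ˡ toList H × (∀ t → f t ≡ g t))
∈ᶠ-representative {f} H f∈ = find f∈

configuration : ∀ {F H A a} β →
  (∀ {P f} → P ∈ˡ toList F → f ∈ˡ toList H → + toℕ a + eval P (+ (∑[ t ∈ β ] toℕ (f t))) ∈ᶻ A) →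
  Configuration F H A a β
configuration {F} {H} {A} {a} β c P f P∈ f∈ with ∈ᶠ-representative H f∈
... | g , g∈ , f≗g = subst (λ n → + toℕ a + eval P (+ sum n) ∈ᶻ A)
  (map-cong (λ t → sym (cong toℕ (f≗g t))) (toList (elements β))) (c P∈ g∈)

self-∈ᶠ : ∀ H {f} → f ∈ˡ toList H → f ∈ᶠ H
self-∈ᶠ H = Any.map λ { refl _ → refl }

module MinimalIdeal (em : ∀ {ℓ} → ExcludedMiddle ℓ) (ext : ∀ {a b} → Extensionality a b)
  (F : List⁺ ℙ) (H : 𝒫fFun) where

  open PolynomialVanDerWaerden em
  open Classical em ext

  private
    total : (ℕ⁺ → ℕ⁺) → List ℕ⁺ → ℤ
    total f β = + sum (map (toℕ ∘ f) β)

    total-additive : ∀ f → Additive (total f)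
    total-additive f γ β = trans (cong (λ xs → + sum xs) (map-++ (toℕ ∘ f) γ β))
      (trans (cong +_ (sum-++ (map (toℕ ∘ f) γ) (map (toℕ ∘ f) β)))
        (ℤₚ.pos-+ (sum (map (toℕ ∘ f) γ)) _))

    ip : ℙ → (ℕ⁺ → ℕ⁺) → List ℕ⁺ → ℤ
    ip P f β = eval P (total f β)

    Φ : List (List ℕ⁺ → ℤ)
    Φ = cartesianProductWith ip (toList F) (toList H)

    degree : ℕ
    degree = sum (map length (toList F))

    Φ-degree : All (Degree≤ degree) Φ
    Φ-degree = All.tabulate λ φ∈ → bound (∈-cartesianProductWith⁻ ip (toList F) (toList H) φ∈)
      where
      bound : ∀ {φ} → ∃[ P ] ∃[ f ] (P ∈ˡ toList F × f ∈ˡ toList H × φ ≡ ip P f) → Degree≤ degree φ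
      bound (P , f , P∈ , f∈ , refl) =
        Degree≤-mono (∈⇒≤sum length P∈) (Degree≤-eval P {total f} (total-additive f))

  -- A finite cover induces a colouring of ℤ, after a translation that moves all relevant points
  -- into the positive integers.
  cover-hit : (Bs : List (ℕ⁺ → Bool)) → (∀ n → Any (λ B → T (B n)) Bs) → Any (λ B → Hit F H (T ∘ B)) Bs
  cover-hit Bs cover with polynomial-van-der-Waerden degree Φ-degree (length Bs) 0
  ... | Cs , recurrent = monochromatic (recurrent χ)
    where
    values : ℤ × List ℕ⁺ → List ℤ
    values (a , β) = a ∷ map (λ φ → a + φ β) Φ

    -- `s` exceeds the absolute value of every point of every configuration in `Cs`. It can be fixed
    -- before `χ` because `Cs` serves all colourings.
    s : ℕ
    s = suc (sum (map ∣_∣ (concatMap values Cs)))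

    place : ℤ → ℕ⁺
    place z = toPositive (+ s + z)

    χ : ℤ → Fin (length Bs)
    χ z = index (cover (place z))

    monochromatic : ∃[ a ] ∃[ β ] ((a , β) ∈ˡ Cs × Beyond 0 β × Monochromatic χ Φ a β) → _
    monochromatic (a , []       , _   , (β≢[] , _)    , _)    = ⊥-elim (β≢[] refl)
    monochromatic (a , (t ∷ ts) , aβ∈ , (_ , inc , _) , mono) =
      Any.map (λ { refl → place a , β , configuration β member }) (∈-lookup (χ a))
      where
      β : 𝒫fℕ
      β = record { elements = t ∷ ts ; increasing = inc }

      placed : ∀ {z} → z ∈ˡ values (a , t ∷ ts) → + toℕ (place z) ≡ + s + z
      placed {z} z∈ = shift-positive z s (s≤s (∈⇒≤sum ∣_∣
        (∈-concatMap⁺ values (Any.map (λ { refl → z∈ }) aβ∈))))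

      member : ∀ {P f} → P ∈ˡ toList F → f ∈ˡ toList H →
        + toℕ (place a) + eval P (+ (∑[ t ∈ β ] toℕ (f t))) ∈ᶻ (T ∘ lookup Bs (χ a))
      member {P} {f} P∈ f∈ =
        place (a + ip P f (t ∷ ts)) ,
        trans (placed (there (∈-map⁺ (λ φ → a + φ (t ∷ ts)) φ∈)))
          (trans (sym (ℤₚ.+-assoc (+ s) a _)) (cong (_+ ip P f (t ∷ ts)) (sym (placed (here refl))))) ,
        subst (λ i → T (lookup Bs i (place (a + ip P f (t ∷ ts))))) (mono φ∈)
          (Anyₚ.lookup-index (cover (place (a + ip P f (t ∷ ts)))))
        where
        φ∈ : ip P f ∈ˡ Φ
        φ∈ = ∈-cartesianProductWith⁺ ip P∈ f∈

  -- A set is small if it is covered by finitely many sets without configurations.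
  Small : Pred (Pred ℕ⁺ 0ℓ) 0ℓ
  Small A = Σ[ Bs ∈ List (ℕ⁺ → Bool) ]
    (All (λ B → ¬ Hit F H (T ∘ B)) Bs × (∀ n → A n → Any (λ B → T (B n)) Bs))

  Hit-⊆ : ∀ {A B} → A ⊆ B → Hit F H A → Hit F H B
  Hit-⊆ A⊆B (a , β , c) = a , β , λ P f P∈ f∈ →
    let (n , eq , n∈) = c P f P∈ f∈ in n , eq , A⊆B n∈

  Rich : Pred βℕ 1ℓ
  Rich q = ∀ A → A ∈ᵘ q → Hit F H A

  small-⊆ : ∀ {A B} → A ⊆ B → Small B → Small A
  small-⊆ A⊆B (Bs , miss , cover) = Bs , miss , λ n a → cover n (A⊆B a)

  small-∅ : Small ∅
  small-∅ = [] , [] , λ _ ()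

  small-∪ : ∀ {A B} → Small A → Small B → Small (A ∪ B)
  small-∪ (Bs , miss , cover) (Cs , miss′ , cover′) = Bs ++ Cs , Allₚ.++⁺ miss miss′ ,
    λ { n (inj₁ a) → Anyₚ.++⁺ˡ (cover n a) ; n (inj₂ b) → Anyₚ.++⁺ʳ Bs (cover′ n b) }

  ¬small-U : ¬ Small U
  ¬small-U (Bs , miss , cover) = Allₚ.All¬⇒¬Any miss (cover-hit Bs λ n → cover n tt)

  ∃-rich : ∃ Rich
  ∃-rich = L.ultrafilter , rich
    where
    module L = UltrafilterLemma Small small-⊆ small-∅ small-∪ ¬small-U

    rich : ∀ A → A ∈ᵘ L.ultrafilter → Hit F H A
    rich A A∈ with em {P = Hit F H A}
    ... | yes hit = hit
    ... | no  ¬hit = ⊥-elim (L.avoids-small A∈ (L.char A ∷ [] ,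
      (λ hit → ¬hit (Hit-⊆ toWitness hit)) ∷ [] , λ n a → here (fromWitness a)))

  rich-left : ∀ q {p} → Rich p → Rich (q ⊕ p)
  rich-left q rich A A∈ with ∈ᵘ-inhabited em q A∈
  ... | x , x∈ with rich _ x∈
  ...   | a , β , c = x +⁺ a , β , λ P f P∈ f∈ → let (n , eq , n∈) = c P f P∈ f∈ in
    x +⁺ n , trans (cong (λ z → + toℕ x + z) eq)
      (sym (ℤₚ.+-assoc (+ toℕ x) (+ toℕ a) (eval P (+ (∑[ t ∈ β ] toℕ (f t)))))) , n∈

  -- A configuration for the points `x` with `-x + A` in `q` asks for finitely many members of `q`;
  -- a common element `y` moves it into `A`.
  rich-right : ∀ q {p} → Rich p → Rich (p ⊕ q)
  rich-right q rich A A∈ with rich _ A∈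
  ... | a , β , c with ∈ᵘ-inhabited em q (⋂-∈ᵘ q (toList F) λ {P} P∈ → ⋂-∈ᵘ q (toList H) λ {f} f∈ →
        shifted P f (c P f P∈ (self-∈ᶠ H f∈)))
    where
    rearrange : ∀ a y e → a + e + y ≡ a + y + e
    rearrange = solve-∀

    shifted : ∀ P f → + toℕ a + eval P (+ (∑[ t ∈ β ] toℕ (f t))) ∈ᶻ (λ x → (λ y → A (x +⁺ y)) ∈ᵘ q) →
      (λ y → + toℕ (a +⁺ y) + eval P (+ (∑[ t ∈ β ] toℕ (f t))) ∈ᶻ A) ∈ᵘ q
    shifted P f (n , eq , n∈) = upward q (λ {y} A∋ → n +⁺ y ,
      trans (cong (_+ + toℕ y) eq)
        (rearrange (+ toℕ a) (+ toℕ y) (eval P (+ (∑[ t ∈ β ] toℕ (f t))))) , A∋) n∈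
  ... | y , c′ = a +⁺ y , β , configuration β λ P∈ f∈ → c′ P∈ f∈

  rich-ideal : IsTwoSidedIdeal Rich
  rich-ideal = record
    { nonempty = ∃-rich
    ; resp     = λ (_ , q⊆p) rich A A∈ → rich A (q⊆p A∈)
    ; left     = rich-left
    ; right    = rich-right
    }

K⊆𝒥ₚ : (∀ {ℓ} → ExcludedMiddle ℓ) → (∀ {a b} → Extensionality a b) → ∀ {p} → p ∈ K → p ∈ 𝒥ₚ
K⊆𝒥ₚ em ext p∈K A A∈ F H = p∈K Rich rich-ideal A A∈
  where open MinimalIdeal em ext F H

-- Finite sets

max-bound : ∀ β {t} → t ∈ˡ toList (elements β) → toℕ t ≤ max β
max-bound β = go (List⁺.head (elements β)) (List⁺.tail (elements β))
  where
  go : ∀ x xs {t} → t ∈ˡ x ∷ xs → toℕ t ≤ List⁺.foldr₁ ℕ._⊔_ (List⁺.map toℕ (x ∷ xs))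
  go x []       (here refl) = ℕₚ.≤-refl
  go x (y ∷ xs) (here refl) = ℕₚ.m≤m⊔n (toℕ x) (List⁺.foldr₁ ℕ._⊔_ (List⁺.map toℕ (y ∷ xs)))
  go x (y ∷ xs) (there t∈)  = ℕₚ.≤-trans (go y xs t∈) (ℕₚ.m≤n⊔m (toℕ x) _)

min-bound : ∀ β {t} → t ∈ˡ toList (elements β) → min β ≤ toℕ t
min-bound β = go (List⁺.head (elements β)) (List⁺.tail (elements β))
  where
  go : ∀ x xs {t} → t ∈ˡ x ∷ xs → List⁺.foldr₁ ℕ._⊓_ (List⁺.map toℕ (x ∷ xs)) ≤ toℕ t
  go x []       (here refl) = ℕₚ.≤-refl
  go x (y ∷ xs) (here refl) = ℕₚ.m⊓n≤m _ _
  go x (y ∷ xs) (there t∈)  = ℕₚ.≤-trans (ℕₚ.m⊓n≤n (toℕ x) _) (go y xs t∈)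

<-min : ∀ {M} β → All (λ t → M < toℕ t) (toList (elements β)) → M < min β
<-min {M} β = go (List⁺.head (elements β)) (List⁺.tail (elements β))
  where
  go : ∀ x xs → All (λ t → M < toℕ t) (x ∷ xs) → M < List⁺.foldr₁ ℕ._⊓_ (List⁺.map toℕ (x ∷ xs))
  go x []       (M<x ∷ [])   = M<x
  go x (y ∷ xs) (M<x ∷ M<xs) = ℕₚ.⊓-pres-m< M<x (go y xs M<xs)

-- Precomposing the functions with `raise M` turns a configuration from the Jₚ-property into one
-- whose index set lies beyond `M`.
raise : ℕ → ℕ⁺ → ℕ⁺
raise M (1+ n) = 1+ (M ℕ.+ n)

raises : ℕ → 𝒫fℕ → 𝒫fℕ
raises M β = record
  { elements   = List⁺.map (raise M) (elements β)
  ; increasing = AllPairsₚ.map⁺ (AllPairs.map (λ { (s≤s t<u) → s≤s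
      (ℕₚ.≤-trans (ℕₚ.≤-reflexive (sym (ℕₚ.+-suc M _))) (ℕₚ.+-monoʳ-≤ M t<u)) }) (increasing β))
  }

<-min-raises : ∀ M β → M < min (raises M β)
<-min-raises M β = <-min (raises M β)
  (Allₚ.map⁺ (All.universal (λ t → s≤s (ℕₚ.m≤m+n M _)) (toList (elements β))))

-- Translation of polynomials without constant term

infixl 6 _⊞_

_⊞_ : ℙ → ℙ → ℙ
[]       ⊞ Q        = Q
(c ∷ P)  ⊞ []       = c ∷ P
(c ∷ P)  ⊞ (d ∷ Q)  = c + d ∷ P ⊞ Q

eval-⊞ : ∀ P Q x → eval (P ⊞ Q) x ≡ eval P x + eval Q x
eval-⊞ []      Q       x = sym (ℤₚ.+-identityˡ _)
eval-⊞ (c ∷ P) []      x = sym (ℤₚ.+-identityʳ _)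
eval-⊞ (c ∷ P) (d ∷ Q) x = trans (cong (λ z → x * (c + d + z)) (eval-⊞ P Q x))
  (ring x c d (eval P x) (eval Q x))
  where
  ring : ∀ x c d p q → x * (c + d + (p + q)) ≡ x * (c + p) + x * (d + q)
  ring = solve-∀

eval-scale : ∀ k P x → eval (map (k *_) P) x ≡ k * eval P x
eval-scale k []      x = sym (ℤₚ.*-zeroʳ k)
eval-scale k (c ∷ P) x = trans (cong (λ z → x * (k * c + z)) (eval-scale k P x)) (ring x k c (eval P x))
  where
  ring : ∀ x k c p → x * (k * c + k * p) ≡ k * (x * (c + p))
  ring = solve-∀

-- With r = P(n + x) - P(n), the recursion is (n + x)(c + P(n + x)) - n(c + P(n)) = x(c + P(n) + r)
-- + n r.
translate : ℙ → ℤ → ℙ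
translate []      n = []
translate (c ∷ P) n = (c + eval P n ∷ translate P n) ⊞ map (n *_) (translate P n)

eval-translate : ∀ P n x → eval (translate P n) x ≡ eval P (n + x) - eval P n
eval-translate []      n x = refl
eval-translate (c ∷ P) n x =
  trans (eval-⊞ (c + eval P n ∷ translate P n) (map (n *_) (translate P n)) x)
  (trans (cong (λ z → x * (c + eval P n + eval (translate P n) x) + z) (eval-scale n (translate P n) x))
  (trans (cong (λ z → x * (c + eval P n + z) + n * z) (eval-translate P n x))
         (ring x n c (eval P n) (eval P (n + x)))))
  where
  ring : ∀ x n c p q → x * (c + p + (q - p)) + n * (q - p) ≡ (n + x) * (c + q) - n * (c + p)
  ring = solve-∀

eval-0 : ∀ P → eval P (+ 0) ≡ + 0
eval-0 []      = refl
eval-0 (c ∷ P) = ℤₚ.*-zeroˡ (c + eval P (+ 0))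

-- Idempotent ultrafilters

+⁺-assoc : ∀ a b c → a +⁺ b +⁺ c ≡ a +⁺ (b +⁺ c)
+⁺-assoc (1+ a) (1+ b) (1+ c) = cong 1+_ (ℕₚ.+-assoc a (suc b) (suc c))

star : βℕ → Pred ℕ⁺ 0ℓ → Pred ℕ⁺ 0ℓ
star p C y = C y × (λ w → C (y +⁺ w)) ∈ᵘ p

star-∈ : ∀ {p C} → p ∈ Idempotent → C ∈ᵘ p → star p C ∈ᵘ p
star-∈ {p} (_ , p⊆p⊕p) C∈ = inter p C∈ (p⊆p⊕p C∈)

-- By associativity the translate of the star is the star of `-x + C`, a set in `p` because `x` lies
-- in the star.
star-shift : ∀ {p C x} → p ∈ Idempotent → star p C x → (λ y → star p C (x +⁺ y)) ∈ᵘ p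
star-shift {p} {C} {x} idem (_ , C-x) = upward p
  (λ { {y} (c , c′) → c , upward p (λ {w} → subst C (sym (+⁺-assoc x y w))) c′ })
  (star-∈ {p} {λ y → C (x +⁺ y)} idem C-x)

-- Finite sets of functions: well-foundedness, canonical lists, subsets

open Setoid 𝒫fFun-setoid using ()
  renaming (refl to ≐ᶠ-refl; sym to ≐ᶠ-sym; trans to ≐ᶠ-trans)

⊊ᶠ-trans : ∀ {F G H} → F ⊊ᶠ G → G ⊊ᶠ H → F ⊊ᶠ H
⊊ᶠ-trans (F⊆G , G⊈F) (G⊆H , _) = (λ f∈ → G⊆H (F⊆G f∈)) , λ H⊆F → G⊈F λ f∈ → H⊆F (G⊆H f∈)

⊊ᶠ-resp : ∀ {F F′ G G′} → F ≐ᶠ F′ → G ≐ᶠ G′ → F ⊊ᶠ G → F′ ⊊ᶠ G′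
⊊ᶠ-resp (F⊆ , ⊆F) (G⊆ , ⊆G) (F⊆G , G⊈F) =
  (λ f∈ → G⊆ (F⊆G (⊆F f∈))) , λ G′⊆F′ → G⊈F λ f∈ → ⊆F (G′⊆F′ (G⊆ f∈))

∈ᶠ-resp : ∀ {f g} G → (∀ t → f t ≡ g t) → g ∈ᶠ G → f ∈ᶠ G
∈ᶠ-resp G f≗g = Any.map λ g≗h t → trans (f≗g t) (g≗h t)

sublists : ∀ {X : Set} → List X → List (List X)
sublists []       = [] ∷ []
sublists (x ∷ xs) = sublists xs ++ map (x ∷_) (sublists xs)

module FiniteSetsOfFunctions (em : ∀ {ℓ} → ExcludedMiddle ℓ) (ext : ∀ {a b} → Extensionality a b) where

  open Classical em ext using (T-antisym)

  filter-∈-sublists : ∀ {X : Set} (P : X → Set) xs → filter (λ x → em {P = P x}) xs ∈ˡ sublists xs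
  filter-∈-sublists P []       = here refl
  filter-∈-sublists P (x ∷ xs) with em {P = P x}
  ... | yes _ = ∈-++⁺ʳ (sublists xs) (∈-map⁺ (x ∷_) (filter-∈-sublists P xs))
  ... | no  _ = ∈-++⁺ˡ (filter-∈-sublists P xs)

  private
    count : {X : Set} (P : X → Set) → List X → ℕ
    count P xs = length (filter (λ x → em {P = P x}) xs)

    count-≤ : ∀ {X : Set} {P Q : X → Set} → (∀ x → P x → Q x) → ∀ xs → count P xs ≤ count Q xs
    count-≤ P⊆Q [] = z≤n
    count-≤ {P = P} {Q} P⊆Q (x ∷ xs) with em {P = P x} | em {P = Q x}
    ... | yes p | yes q = s≤s (count-≤ P⊆Q xs)
    ... | yes p | no ¬q = ⊥-elim (¬q (P⊆Q x p))
    ... | no  _ | yes q = ℕₚ.m≤n⇒m≤1+n (count-≤ P⊆Q xs)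
    ... | no  _ | no  _ = count-≤ P⊆Q xs

    count-< : ∀ {X : Set} {P Q : X → Set} → (∀ x → P x → Q x) → ∀ {x xs} → x ∈ˡ xs → ¬ P x → Q x →
      count P xs < count Q xs
    count-< {P = P} {Q} P⊆Q {xs = x ∷ xs} (here refl) ¬p q with em {P = P x} | em {P = Q x}
    ... | yes p | _     = ⊥-elim (¬p p)
    ... | no  _ | yes _ = s≤s (count-≤ P⊆Q xs)
    ... | no  _ | no ¬q = ⊥-elim (¬q q)
    count-< {P = P} {Q} P⊆Q {xs = x ∷ xs} (there y∈) ¬p q with em {P = P x} | em {P = Q x}
    ... | yes _ | yes _ = s≤s (count-< P⊆Q y∈ ¬p q)
    ... | yes p | no ¬q = ⊥-elim (¬q (P⊆Q x p))
    ... | no  _ | yes _ = ℕₚ.m<n⇒m<1+n (count-< P⊆Q y∈ ¬p q)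
    ... | no  _ | no  _ = count-< P⊆Q y∈ ¬p q

    size : 𝒫fFun → 𝒫fFun → ℕ
    size G K = count (_∈ᶠ K) (toList G)

    witness : ∀ {G K} → K ⊊ᶠ G → ∃[ g ] (g ∈ˡ toList G × ¬ (g ∈ᶠ K))
    witness {G} {K} (_ , G⊈K) with em {P = ∃[ g ] (g ∈ˡ toList G × ¬ (g ∈ᶠ K))}
    ... | yes w = w
    ... | no ¬w = ⊥-elim (G⊈K λ {f} f∈ → let (g , g∈ , f≗g) = ∈ᶠ-representative G f∈ in
      ∈ᶠ-resp K f≗g (decide g g∈))
      where
      decide : ∀ g → g ∈ˡ toList G → g ∈ᶠ K
      decide g g∈ with em {P = g ∈ᶠ K}
      ... | yes g∈K = g∈K
      ... | no  g∉K = ⊥-elim (¬w (g , g∈ , g∉K))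

    size-< : ∀ {Top K G} → G ⊆ᶠ Top → K ⊊ᶠ G → size Top K < size Top G
    size-< {Top} {K} {G} G⊆Top K⊊G with witness K⊊G
    ... | g , g∈ , g∉K with ∈ᶠ-representative Top (G⊆Top (self-∈ᶠ G g∈))
    ...   | t , t∈ , g≗t = count-< (λ f f∈ → proj₁ K⊊G f∈) t∈
      (λ t∈K → g∉K (∈ᶠ-resp K g≗t t∈K)) (∈ᶠ-resp G (λ x → sym (g≗t x)) (self-∈ᶠ G g∈))

  abstract
    -- Inside a fixed `Top`, the number of entries of `Top` belonging to a set strictly decreases
    -- along proper inclusion, whatever lists represent the sets.
    ⊊ᶠ-wellFounded : WellFounded _⊊ᶠ_
    ⊊ᶠ-wellFounded Top = go (suc (size Top Top)) Top (λ f∈ → f∈) ℕₚ.≤-refl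
      where
      go : ∀ n G → G ⊆ᶠ Top → size Top G < n → Acc _⊊ᶠ_ G
      go (suc n) G G⊆Top (s≤s size≤n) = acc λ {K} K⊊G → go n K (λ f∈ → G⊆Top (proj₁ K⊊G f∈))
        (ℕₚ.<-≤-trans (size-< {Top} G⊆Top K⊊G) size≤n)

  private
    choose : (𝒫fFun → Bool) → 𝒫fFun
    choose χ with em {P = ∃[ K ] T (χ K)}
    ... | yes (K , _) = K
    -- Default for an empty class; `class G` always contains `G`.
    ... | no  _       = (λ t → t) ∷ []

    class : 𝒫fFun → 𝒫fFun → Bool
    class G K = ⌊ em {P = K ≐ᶠ G} ⌋

  -- Excluded middle for types chooses an element of each inhabited type; the class of G is coded
  -- by a Boolean function so that extensionality makes the choice independent of G.
  canonical : 𝒫fFun → 𝒫fFun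
  canonical G = choose (class G)

  canonical-≐ : ∀ G → canonical G ≐ᶠ G
  canonical-≐ G with em {P = ∃[ K ] T (class G K)}
  ... | yes (K , K≐G) = toWitness K≐G
  ... | no  none      = ⊥-elim (none (G , fromWitness {a? = em {P = G ≐ᶠ G}} (≐ᶠ-refl {G})))

  canonical-cong : ∀ {G K} → G ≐ᶠ K → canonical G ≡ canonical K
  canonical-cong {G} {K} G≐K = cong choose (ext λ F → T-antisym
    (λ t → fromWitness {a? = em {P = F ≐ᶠ K}} (≐ᶠ-trans {F} {G} {K} (toWitness t) G≐K))
    (λ t → fromWitness {a? = em {P = F ≐ᶠ G}}
      (≐ᶠ-trans {F} {K} {G} (toWitness t) (≐ᶠ-sym {G} {K} G≐K))))

  private
    -- The empty sublist is replaced by `G`, which `gatherAt` later discards as improper.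
    nonempty : 𝒫fFun → List (ℕ⁺ → ℕ⁺) → 𝒫fFun
    nonempty G []       = G
    nonempty G (f ∷ fs) = f ∷ fs

    toList-nonempty : ∀ G {f fs} → f ∈ˡ fs → toList (nonempty G fs) ≡ fs
    toList-nonempty G {fs = _ ∷ _} _ = refl

  subsets : 𝒫fFun → List 𝒫fFun
  subsets G = map (nonempty G) (sublists (toList G))

  subsets-complete : ∀ {K G} → K ⊆ᶠ G → ∃[ L ] (L ∈ˡ subsets G × L ≐ᶠ K)
  subsets-complete {K} {G} K⊆G = nonempty G fs ,
    ∈-map⁺ (nonempty G) (filter-∈-sublists (_∈ᶠ K) (toList G)) ,
    (λ {f} f∈ → fs⊆K (subst (Any (λ g → ∀ t → f t ≡ g t)) fs≡ f∈)) ,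
    (λ {f} f∈ → subst (Any (λ g → ∀ t → f t ≡ g t)) (sym fs≡) (K⊆fs f∈))
    where
    fs : List (ℕ⁺ → ℕ⁺)
    fs = filter (λ f → em {P = f ∈ᶠ K}) (toList G)

    K⊆fs : ∀ {f} → f ∈ᶠ K → Any (λ g → ∀ t → f t ≡ g t) fs
    K⊆fs {f} f∈ with ∈ᶠ-representative G (K⊆G f∈)
    ... | g , g∈ , f≗g = Any.map (λ { refl → f≗g }) (∈-filter⁺ (λ f → em {P = f ∈ᶠ K}) g∈
      (∈ᶠ-resp K (λ t → sym (f≗g t)) f∈))

    fs⊆K : ∀ {f} → Any (λ g → ∀ t → f t ≡ g t) fs → f ∈ᶠ K
    fs⊆K f∈ with find f∈
    ... | g , g∈ , f≗g = ∈ᶠ-resp K f≗g (proj₂ (∈-filter⁻ (λ f → em {P = f ∈ᶠ K}) {xs = toList G} g∈))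

    fs≡ : toList (nonempty G fs) ≡ fs
    fs≡ = toList-nonempty G (proj₁ (proj₂ (find (K⊆fs (here {x = List⁺.head K} λ _ → refl)))))

-- The recursive choice of α and H

-- The position in the middle of block k = length done + 1: x₁, …, x_{k-1} are done, P_k = poly,
-- and the part of the block seen so far contributes Σ α = offset and Σ Σ f = mass.
record State : Set where
  constructor state
  field
    done   : List ℕ⁺
    poly   : ℙ
    offset : ℕ
    mass   : ℕ

open State

value : State → ℤ
value s = + offset s + eval (poly s) (+ mass s)

advance : State → ℕ → ℕ → State
advance s a n = record s { offset = offset s ℕ.+ a ; mass = mass s ℕ.+ n }

fresh : List ℕ⁺ → ℙ → State
fresh xs P = state xs P 0 0

finish : State → ℙ → State
finish s P = fresh (done s ∷ʳ toPositive (value s)) P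

value-fresh : ∀ xs P → value (fresh xs P) ≡ + 0
value-fresh xs P = trans (ℤₚ.+-identityˡ _) (eval-0 P)

value-advance : ∀ s a n →
  value (advance s a n) ≡ value s + (+ a + eval (translate (poly s) (+ mass s)) (+ n))
value-advance s a n = sym (trans
  (cong (λ z → value s + (+ a + z)) (eval-translate (poly s) (+ mass s) (+ n)))
  (ring (+ offset s) (+ a) (eval (poly s) (+ mass s)) (eval (poly s) (+ (mass s ℕ.+ n)))))
  where
  ring : ∀ o a p q → o + p + (a + (q - p)) ≡ o + a + q
  ring = solve-∀

advance-advance : ∀ s a b m n → advance (advance s a m) b n ≡ advance s (a ℕ.+ b) (m ℕ.+ n)
advance-advance s a b m n = cong₂ (state (done s) (poly s))
  (ℕₚ.+-assoc (offset s) a b) (ℕₚ.+-assoc (mass s) m n)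

∑-raises : ∀ M β (f : ℕ⁺ → ℕ⁺) → (∑[ t ∈ β ] toℕ (f (raise M t))) ≡ (∑[ t ∈ raises M β ] toℕ (f t))
∑-raises M β f = cong sum (map-∘ {g = toℕ ∘ f} {raise M} (toList (elements β)))

-- `W xs` says that `xs` is a node of the tree from which the remaining coordinates can be found.
-- `class k` tells which of the `J`-indexed pairs of functions serves coordinate `k`; a one-point
-- `J` gives a single pair for all.
module Construction
  (em : ∀ {ℓ} → ExcludedMiddle ℓ) (ext : ∀ {a b} → Extensionality a b)
  (p : ℕ → βℕ) (idempotent : ∀ k → p k ∈ Idempotent)
  (W : List ℕ⁺ → Set) (W-next : ∀ xs → W xs → (λ y → W (xs ∷ʳ y)) ∈ᵘ p (length xs))
  (J : Set) (class : ℕ → J) (q : J → βℕ) (q∈𝒥ₚ : ∀ j → q j ∈ 𝒥ₚ)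
  (p⊆q : ∀ k A → A ∈ᵘ p k → A ∈ᵘ q (class k))
  (Ps : List⁺ ℙ)
  where

  open FiniteSetsOfFunctions em ext

  target : List ℕ⁺ → Pred ℕ⁺ 0ℓ
  target xs = star (p (length xs)) (λ y → W (xs ∷ʳ y))

  index-of : State → J
  index-of s = class (length (done s))

  -- For a fresh state this says that the target belongs to the ultrafilter, and for a later one
  -- that its translate by the current value does.
  Live : State → Set
  Live s = (λ y → value s + + toℕ y ∈ᶻ target (done s)) ∈ᵘ p (length (done s))

  live-fresh : ∀ {xs} P → W xs → Live (fresh xs P)
  live-fresh {xs} P w = upward (p (length xs))
    (λ {y} y∈ → y , sym (trans (cong (_+ + toℕ y) (value-fresh xs P)) (ℤₚ.+-identityˡ _)) , y∈)
    (star-∈ {p (length xs)} {λ y → W (xs ∷ʳ y)} (idempotent (length xs)) (W-next xs w))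

  live-target : ∀ s → value s ∈ᶻ target (done s) → Live s
  live-target s (x , eq , x∈) = upward (p (length (done s))) {A = λ y → target (done s) (x +⁺ y)}
    (λ {y} y∈ → x +⁺ y , cong (_+ + toℕ y) eq , y∈)
    (star-shift {p (length (done s))} {λ y → W (done s ∷ʳ y)} (idempotent (length (done s))) x∈)

  W-finish : ∀ {z xs} → z ∈ᶻ target xs → W (xs ∷ʳ toPositive z)
  W-finish {xs = xs} (x , eq , w , _) = subst (λ y → W (xs ∷ʳ y)) (sym (toPositive-+ eq)) w

  Choice : List State → 𝒫fFun → ℕ → J → Set
  Choice prior G M j = Σ[ a ∈ ℕ⁺ ] Σ[ β ∈ 𝒫fℕ ] (M < min β ×
    (∀ {s} → s ∈ˡ prior → index-of s ≡ j → Live s → ∀ {f} → f ∈ᶠ G →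
      value (advance s (toℕ a) (∑[ t ∈ β ] toℕ (f t))) ∈ᶻ target (done s)))

  choice : ∀ prior G M j → Choice prior G M j
  choice prior G M j = conclude (q∈𝒥ₚ j (λ y → ∀ {s} → s ∈ˡ prior → Allowed s y)
      (⋂-∈ᵘ (q j) prior λ {s} _ → allowed s) polys raised)
    where
    -- States that are not live, or belong to another class, impose no condition, so every
    -- `Allowed s` is a member of `q j`.
    Allowed : State → Pred ℕ⁺ 0ℓ
    Allowed s y = index-of s ≡ j → Live s → value s + + toℕ y ∈ᶻ target (done s)

    allowed : ∀ s → Allowed s ∈ᵘ q j
    allowed s with em {P = index-of s ≡ j × Live s}
    ... | yes (refl , live) = upward (q j) (λ y∈ _ _ → y∈) (p⊆q (length (done s)) _ live)
    ... | no  ¬live         = upward (q j) (λ _ eq live → ⊥-elim (¬live (eq , live))) (whole (q j))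

    move : State → ℙ
    move s = translate (poly s) (+ mass s)

    -- The leading zero polynomial keeps the list nonempty.
    polys : List⁺ ℙ
    polys = [] ∷ map move prior

    raised : 𝒫fFun
    raised = List⁺.map (λ f t → f (raise M t)) G

    conclude : Hit polys raised (λ y → ∀ {s} → s ∈ˡ prior → Allowed s y) → Choice prior G M j
    conclude (a , β , c) = a , raises M β , <-min-raises M β , chosen
      where
      chosen : ∀ {s} → s ∈ˡ prior → index-of s ≡ j → Live s → ∀ {f} → f ∈ᶠ G →
        value (advance s (toℕ a) (∑[ t ∈ raises M β ] toℕ (f t))) ∈ᶻ target (done s)
      chosen {s} s∈ eq live {f} f∈
        with c (move s) (λ t → f (raise M t)) (there (∈-map⁺ move s∈))
               (Anyₚ.map⁺ (Any.map (λ f≗g t → f≗g (raise M t)) f∈))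
      ... | n , n≡ , n∈ with n∈ s∈ eq live
      ...   | x , x≡ , x∈ = x , trans x≡ (trans (cong (λ z → value s + z) n≡) (trans
                (cong (λ n → value s + (+ toℕ a + eval (move s) (+ n))) (∑-raises M β f))
                (sym (value-advance s (toℕ a) (∑[ t ∈ raises M β ] toℕ (f t)))))) , x∈

  -- `reached` records every state in which a play can be after its move at the given set; stages of
  -- larger sets must answer all of them.
  record Stage : Set where
    constructor stage
    field
      α       : J → ℕ⁺
      H       : J → 𝒫fℕ
      reached : List State

  open Stage

  play : Stage → State → (ℕ⁺ → ℕ⁺) → State
  play S s f = advance s (toℕ (α S (index-of s))) (∑[ t ∈ H S (index-of s) ] toℕ (f t))

  starts : List State
  starts = map (fresh []) (toList Ps)

  prior : List Stage → List State
  prior earlier = starts ++ concatMap reached earlier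

  -- After a move the current block either continues or ends, and in the latter case the polynomial
  -- of the next block is guessed.
  outcomes : Stage → State × (ℕ⁺ → ℕ⁺) → List State
  outcomes S (s , f) = play S s f ∷ map (finish (play S s f)) (toList Ps)

  ceiling : List Stage → J → ℕ
  ceiling earlier j = sum (map (λ S → max (H S j)) earlier)

  choiceAt : ∀ earlier G j → Choice (prior earlier) G (ceiling earlier j) j
  choiceAt earlier G j = choice (prior earlier) G (ceiling earlier j) j

  choices : List Stage → 𝒫fFun → Stage
  choices earlier G = stage
    (λ j → proj₁ (choiceAt earlier G j)) (λ j → proj₁ (proj₂ (choiceAt earlier G j))) []

  build : List Stage → 𝒫fFun → Stage
  build earlier G = record (choices earlier G)
    { reached = concatMap (outcomes (choices earlier G)) (cartesianProduct (prior earlier) (toList G)) }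

  record Spec (earlier : List Stage) (G : 𝒫fFun) (S : Stage) : Set where
    field
      above   : ∀ {S′} → S′ ∈ˡ earlier → ∀ j → H S′ j ≺ H S j
      hits    : ∀ {s} → s ∈ˡ prior earlier → Live s → ∀ {f} → f ∈ᶠ G →
                value (play S s f) ∈ᶻ target (done s)
      goes-on : ∀ {s} → s ∈ˡ prior earlier → ∀ {f} → f ∈ᶠ G → play S s f ∈ˡ reached S
      ends    : ∀ {s} → s ∈ˡ prior earlier → ∀ {f} → f ∈ᶠ G → ∀ {P} → P ∈⁺ Ps →
                finish (play S s f) P ∈ˡ reached S

  build-spec : ∀ earlier G → Spec earlier G (build earlier G)
  build-spec earlier G = record
    { above   = λ S′∈ j → ℕₚ.≤-<-trans (∈⇒≤sum (λ S → max (H S j)) S′∈)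
        (proj₁ (proj₂ (proj₂ (choiceAt earlier G j))))
    ; hits    = λ {s} s∈ live f∈ →
        proj₂ (proj₂ (proj₂ (choiceAt earlier G (index-of s)))) s∈ refl live f∈
    ; goes-on = λ {s} s∈ f∈ → reach s∈ f∈ (λ s′ → s′) λ _ → here refl
    ; ends    = λ {s} s∈ f∈ {P} P∈ → reach s∈ f∈ (λ s′ → finish s′ P) λ g → there (∈-map⁺ _ P∈)
    }
    where
    S : Stage
    S = choices earlier G

    reach : ∀ {s f} → s ∈ˡ prior earlier → f ∈ᶠ G → (F : State → State) →
      (∀ g → F (play S s g) ∈ˡ outcomes S (s , g)) → F (play S s f) ∈ˡ reached (build earlier G)
    reach {s} {f} s∈ f∈ F F∈ with ∈ᶠ-representative G f∈
    ... | g , g∈ , f≗g = subst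
      (λ n → F (advance s (toℕ (α S (index-of s))) (sum n)) ∈ˡ reached (build earlier G))
      (map-cong (λ t → sym (cong toℕ (f≗g t))) (toList (elements (H S (index-of s)))))
      (∈-concatMap⁺ (outcomes S) (Any.map (λ { refl → F∈ g }) (∈-cartesianProduct⁺ s∈ g∈)))

  -- Recursive calls go to canonical lists, the only ones at which `stageOf` evaluates.
  gatherAt : ∀ G → (∀ K → K ⊊ᶠ G → Stage) → 𝒫fFun → List Stage
  gatherAt G IH K with em {P = canonical K ⊊ᶠ G}
  ... | yes K⊊G = IH (canonical K) K⊊G ∷ []
  ... | no  _   = []

  gather : ∀ G → (∀ K → K ⊊ᶠ G → Stage) → List Stage
  gather G IH = concatMap (gatherAt G IH) (subsets G)

  private
    stageFrom : ∀ G → Acc _⊊ᶠ_ G → Stage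
    stageFrom G (acc rs) = build (gather G λ K K⊊G → stageFrom K (rs K⊊G)) G

    -- Extensionality identifies recursive calls made with different accessibility proofs; this
    -- yields the fixed-point equation `stageAt-unfold`.
    stageFrom-irrelevant : ∀ G (a b : Acc _⊊ᶠ_ G) → stageFrom G a ≡ stageFrom G b
    stageFrom-irrelevant G (acc rs) (acc rs′) = cong (λ IH → build (gather G IH) G)
      (ext λ K → ext λ K⊊G → stageFrom-irrelevant K (rs K⊊G) (rs′ K⊊G))

  abstract
    stageAt : 𝒫fFun → Stage
    stageAt G = stageFrom G (⊊ᶠ-wellFounded G)

    stageAt-unfold : ∀ G → stageAt G ≡ build (gather G λ K _ → stageAt K) G
    stageAt-unfold G with ⊊ᶠ-wellFounded G
    ... | acc rs = cong (λ IH → build (gather G IH) G)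
      (ext λ K → ext λ K⊊G → stageFrom-irrelevant K (rs K⊊G) (⊊ᶠ-wellFounded K))

  earlier : 𝒫fFun → List Stage
  earlier G = gather G λ K _ → stageAt K

  stageAt-spec : ∀ G → Spec (earlier G) G (stageAt G)
  stageAt-spec G = subst (Spec (earlier G) G) (sym (stageAt-unfold G)) (build-spec (earlier G) G)

  earlier-complete : ∀ {K G} → K ⊊ᶠ G → stageAt (canonical K) ∈ˡ earlier G
  earlier-complete {K} {G} K⊊G with subsets-complete {K} {G} (proj₁ K⊊G)
  ... | L , L∈ , L≐K = ∈-concatMap⁺ (gatherAt G λ K _ → stageAt K) (Any.map (λ { refl → at-∈ }) L∈)
    where
    at-∈ : stageAt (canonical K) ∈ˡ gatherAt G (λ K _ → stageAt K) L
    at-∈ with em {P = canonical L ⊊ᶠ G}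
    ... | yes _   = here (cong stageAt (canonical-cong {K} {L} (≐ᶠ-sym {L} {K} L≐K)))
    ... | no  L⊈G = ⊥-elim (L⊈G (⊊ᶠ-resp {K} {canonical L} {G} {G}
      (≐ᶠ-trans {K} {L} {canonical L} (≐ᶠ-sym {L} {K} L≐K) (≐ᶠ-sym {canonical L} {L} (canonical-≐ L)))
      (≐ᶠ-refl {G}) K⊊G))

  stageOf : 𝒫fFun → Stage
  stageOf G = stageAt (canonical G)

  αₛ : J → 𝒫fFun⟶ℕ⁺
  αₛ j = record
    { to   = λ G → α (stageOf G) j
    ; cong = λ {G} {K} G≐K → cong (λ F → α (stageAt F) j) (canonical-cong {G} {K} G≐K)
    }

  Hₛ : J → 𝒫fFun⟶𝒫fℕ
  Hₛ j = record
    { to   = λ G → H (stageOf G) j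
    ; cong = λ {G} {K} G≐K → cong (λ F → elements (H (stageAt F) j)) (canonical-cong {G} {K} G≐K)
    }

  stageOf-earlier : ∀ {G K} → G ⊊ᶠ K → stageOf G ∈ˡ earlier (canonical K)
  stageOf-earlier {G} {K} G⊊K = earlier-complete {G} {canonical K}
    (⊊ᶠ-resp {G} {G} {K} {canonical K} (≐ᶠ-refl {G}) (≐ᶠ-sym {canonical K} {K} (canonical-≐ K)) G⊊K)

  Hₛ-increasing : ∀ {G K} → G ⊊ᶠ K → ∀ j → Hₛ j ⟨$⟩ G ≺ Hₛ j ⟨$⟩ K
  Hₛ-increasing {G} {K} G⊊K = Spec.above (stageAt-spec (canonical K)) (stageOf-earlier {G} {K} G⊊K)

  -- Playing along an increasing sequence of sets

  module Run
    (G : ℕ⁺ → 𝒫fFun) (G-increasing : ∀ n → G n ⊊ᶠ G (suc⁺ n))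
    (f : ℕ⁺ → ℕ⁺ → ℕ⁺) (f∈ : ∀ i → f i ∈ᶠ G i)
    where

    G-mono : ∀ {i k} → toℕ i < toℕ k → G i ⊊ᶠ G k
    G-mono {1+ i} {1+ k} (s≤s i<k) = go (ℕₚ.≤⇒≤′ i<k)
      where
      go : ∀ {k} → suc i ℕ.≤′ k → G (1+ i) ⊊ᶠ G (1+ k)
      go ℕ.≤′-refl           = G-increasing (1+ i)
      go {suc k} (ℕ.≤′-step i<k) =
        ⊊ᶠ-trans {G (1+ i)} {G (1+ k)} {G (1+ suc k)} (go i<k) (G-increasing (1+ k))

    -- `l` bounds the indices already consumed: every later stage has `s` among the states it
    -- answers.
    Ready : State → ℕ → Set
    Ready s l = ∀ {i} → l < toℕ i → s ∈ˡ prior (earlier (canonical (G i)))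

    move : State → ℕ⁺ → State
    move s i = play (stageOf (G i)) s (f i)

    f∈-canonical : ∀ i → f i ∈ᶠ canonical (G i)
    f∈-canonical i = proj₂ (canonical-≐ (G i)) (f∈ i)

    move-hits : ∀ {s l i} → Ready s l → Live s → l < toℕ i → value (move s i) ∈ᶻ target (done s)
    move-hits {i = i} ready live l<i =
      Spec.hits (stageAt-spec (canonical (G i))) (ready l<i) live (f∈-canonical i)

    reached-ready : ∀ {s i} → s ∈ˡ reached (stageOf (G i)) → Ready s (toℕ i)
    reached-ready {i = i} s∈ {k} i<k = ∈-++⁺ʳ starts (∈-concatMap⁺ reached
      (Any.map (λ { refl → s∈ }) (stageOf-earlier {G i} {G k} (G-mono i<k))))

    run : State → List ℕ⁺ → State
    run s []       = s
    run s (i ∷ is) = run (move s i) is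

    total-α total-H : J → List ℕ⁺ → ℕ
    total-α j is = sum (map (λ i → toℕ (αₛ j ⟨$⟩ G i)) is)
    total-H j is = sum (map (λ i → ∑[ t ∈ Hₛ j ⟨$⟩ G i ] toℕ (f i t)) is)

    run-advance : ∀ s is → run s is ≡ advance s (total-α (index-of s) is) (total-H (index-of s) is)
    run-advance s []       = cong₂ (state (done s) (poly s))
      (sym (ℕₚ.+-identityʳ (offset s))) (sym (ℕₚ.+-identityʳ (mass s)))
    run-advance s (i ∷ is) = trans (run-advance (move s i) is) (advance-advance s _ _ _ _)

    -- A move lands in the starred target, so the new state is live again, and it was recorded in
    -- `reached`, so the next stage answers it.
    run-hits : ∀ i is {s l} → Ready s l → Live s → l < toℕ i → AllPairs (_<_ on toℕ) (i ∷ is) →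
      value (run s (i ∷ is)) ∈ᶻ target (done s) ×
      (∀ {P} → P ∈⁺ Ps → ∀ {l′} → All (λ t → toℕ t ≤ l′) (i ∷ is) →
        Ready (finish (run s (i ∷ is)) P) l′)
    run-hits i [] ready live l<i _ = move-hits ready live l<i ,
      λ { P∈ (i≤l′ ∷ []) l′<k → reached-ready {i = i}
            (Spec.ends (stageAt-spec (canonical (G i))) (ready l<i) (f∈-canonical i) P∈)
            (ℕₚ.≤-<-trans i≤l′ l′<k) }
    run-hits i (k ∷ is) {s} ready live l<i ((i<k ∷ _) ∷ inc) =
      let (hit , ends) = run-hits k is {move s i}
            (reached-ready {i = i}
              (Spec.goes-on (stageAt-spec (canonical (G i))) (ready l<i) (f∈-canonical i)))
            (live-target (move s i) (move-hits ready live l<i)) i<k inc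
      in hit , λ { P∈ (_ ∷ ≤l′) → ends P∈ ≤l′ }

    entry : ℕ → 𝒫fℕ → ℙ → ℤ
    entry k β P = + total-α (class k) (toList (elements β)) +
      eval P (+ total-H (class k) (toList (elements β)))

    -- Induction on the remaining blocks: the value closing a block lies in the target, so appending
    -- it preserves `W`, and the fresh state for the next block was recorded for any polynomial.
    blocks : ∀ n xs {l} → W xs → (∀ {P} → P ∈⁺ Ps → Ready (fresh xs P) l) →
      (β : Fin n → 𝒫fℕ) → (∀ j k → j Fin.< k → β j ≺ β k) →
      (∀ j {t} → t ∈ˡ toList (elements (β j)) → l < toℕ t) →
      (P : Fin n → ℙ) → (∀ j → P j ∈⁺ Ps) →
      ∃[ v ] ((∀ j → + toℕ (Vec.lookup v j) ≡ entry (length xs ℕ.+ Fin.toℕ j) (β j) (P j)) ×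
        W (xs ++ Vec.toList v))
    blocks zero    xs w ready β β-inc l<β P P∈ = [] , (λ ()) , subst W (sym (++-identityʳ xs)) w
    blocks (suc n) xs w ready β β-inc l<β P P∈ =
      let (hit , ends) = run-hits i is (ready (P∈ Fin.zero)) (live-fresh (P Fin.zero) w)
            (l<β Fin.zero (here refl)) (increasing (β Fin.zero))
          (v , v-entries , w′) = blocks n (xs ∷ʳ x) (W-finish hit)
            (λ Q∈ → subst (λ zs → Ready (fresh (zs ∷ʳ x) _) (max (β Fin.zero))) done-s
              (ends Q∈ (All.tabulate (max-bound (β Fin.zero)))))
            (β ∘ Fin.suc) (λ j k j<k → β-inc (Fin.suc j) (Fin.suc k) (s≤s j<k))
            (λ j t∈ → ℕₚ.<-≤-trans (β-inc Fin.zero (Fin.suc j) (s≤s z≤n))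
              (min-bound (β (Fin.suc j)) t∈))
            (P ∘ Fin.suc) (P∈ ∘ Fin.suc)
      in x ∷ v ,
         (λ { Fin.zero    → trans (toℕ-x hit) (trans
                (cong value (run-advance (fresh xs (P Fin.zero)) (i ∷ is)))
                (cong (λ k → entry k (β Fin.zero) (P Fin.zero)) (sym (ℕₚ.+-identityʳ (length xs)))))
            ; (Fin.suc j) → trans (v-entries j) (cong (λ k → entry k (β (Fin.suc j)) (P (Fin.suc j)))
                (trans (cong (ℕ._+ Fin.toℕ j) (length-++ xs)) (ℕₚ.+-assoc (length xs) 1 (Fin.toℕ j)))) }) ,
         subst W (++-assoc xs (x ∷ []) (Vec.toList v)) w′
      where
      i : ℕ⁺
      i = List⁺.head (elements (β Fin.zero))

      is : List ℕ⁺
      is = List⁺.tail (elements (β Fin.zero))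

      s : State
      s = run (fresh xs (P Fin.zero)) (i ∷ is)

      x : ℕ⁺
      x = toPositive (value s)

      done-s : done s ≡ xs
      done-s = cong done (run-advance (fresh xs (P Fin.zero)) (i ∷ is))

      toℕ-x : value s ∈ᶻ target xs → + toℕ x ≡ value s
      toℕ-x (n , eq , _) = trans (cong (λ y → + toℕ y) (toPositive-+ eq)) eq

-- Tensor products as trees, and the conclusion

extend : ∀ {a} {X : Set a} {n} → (Fin n → X) → X → ℕ → X
extend {n = zero}  g d k       = d
extend {n = suc n} g d zero    = g Fin.zero
extend {n = suc n} g d (suc k) = extend (g ∘ Fin.suc) d k

extend-all : ∀ {a b} {X : Set a} (Q : X → Set b) {n} {g : Fin n → X} {d} →
  (∀ i → Q (g i)) → Q d → ∀ k → Q (extend g d k)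
extend-all Q {zero}  Qg Qd k       = Qd
extend-all Q {suc n} Qg Qd zero    = Qg Fin.zero
extend-all Q {suc n} Qg Qd (suc k) = extend-all Q (Qg ∘ Fin.suc) Qd k

-- B ∈ p₁ ⊗ ⋯ ⊗ pₙ, unfolded from the first coordinate rather than from the last.
Win : ∀ n → (Fin n → βℕ) → Pred (Vec ℕ⁺ n) 0ℓ → Set
Win zero    p B = B []
Win (suc n) p B = (λ x → Win n (p ∘ Fin.suc) (λ v → B (x ∷ v))) ∈ᵘ p Fin.zero

-- Associativity of the tensor product: `⨂` splits off the last coordinate, `Win` the first.
Win-∷ʳ : ∀ n p (B : Pred (Vec ℕ⁺ (suc n)) 0ℓ) →
  Win n (p ∘ inject₁) (λ v → (λ y → B (v Vec.∷ʳ y)) ∈ᵘ p (fromℕ n)) → Win (suc n) p B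
Win-∷ʳ zero    p B w = w
Win-∷ʳ (suc n) p B w = upward (p Fin.zero) (λ {x} → Win-∷ʳ n (p ∘ Fin.suc) (λ v → B (x ∷ v))) w

⨂-Win : ∀ n p (B : Pred (Vec ℕ⁺ (suc n)) 0ℓ) → B ∈ᵘ ⨂ p → Win (suc n) p B
⨂-Win zero    p B B∈ = B∈
⨂-Win (suc n) p B B∈ = Win-∷ʳ (suc n) p B (⨂-Win n (p ∘ inject₁) _ B∈)

-- Entries of the list beyond the n-th are ignored.
WinAfter : ∀ n → (Fin n → βℕ) → Pred (Vec ℕ⁺ n) 0ℓ → List ℕ⁺ → Set
WinAfter n       p B []       = Win n p B
WinAfter zero    p B (_ ∷ _)  = B []
WinAfter (suc n) p B (x ∷ xs) = WinAfter n (p ∘ Fin.suc) (λ v → B (x ∷ v)) xs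

WinAfter-next : ∀ n p d B xs → WinAfter n p B xs →
  (λ y → WinAfter n p B (xs ∷ʳ y)) ∈ᵘ extend p d (length xs)
WinAfter-next zero    p d B []       w = upward d (λ _ → w) (whole d)
WinAfter-next zero    p d B (_ ∷ _)  w = upward d (λ _ → w) (whole d)
WinAfter-next (suc n) p d B []       w = w
WinAfter-next (suc n) p d B (x ∷ xs) w = WinAfter-next n (p ∘ Fin.suc) d (λ v → B (x ∷ v)) xs w

WinAfter-all : ∀ n p B v → WinAfter n p B (Vec.toList v) → B v
WinAfter-all zero    p B []      w = w
WinAfter-all (suc n) p B (x ∷ v) w = WinAfter-all n (p ∘ Fin.suc) (λ u → B (x ∷ u)) v w

module _ (em : ∀ {ℓ} → ExcludedMiddle ℓ) (ext : ∀ {a b} → Extensionality a b) where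

  module _ {n} (h : Vec ℕ⁺ (suc n) → ℕ⁺) (p : Fin (suc n) → βℕ) (p∈ : ∀ i → p i ∈ 𝒥ₚ-Idempotent)
    (A : Pred ℕ⁺ 0ℓ) (A∈ : A ∈ᵘ (h ~) (⨂ p)) (Ps : List⁺ ℙ) where

    -- States in `reached` may have more coordinates than `h`; the surplus ones receive the first
    -- ultrafilter, so every coordinate has an idempotent of `𝒥ₚ`.
    p̂ : ℕ → βℕ
    p̂ = extend p (p Fin.zero)

    captures : (J : Set) (class : ℕ → J) (q : J → βℕ) → (∀ j → q j ∈ 𝒥ₚ) →
      (∀ k B → B ∈ᵘ p̂ k → B ∈ᵘ q (class k)) →
      Σ[ α ∈ (J → 𝒫fFun⟶ℕ⁺) ] Σ[ H ∈ (J → 𝒫fFun⟶𝒫fℕ) ]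
        (Increasing (λ (i : Fin (suc n)) → H (class (Fin.toℕ i))) ×
         Captures h A Ps (λ i → α (class (Fin.toℕ i))) (λ i → H (class (Fin.toℕ i))))
    captures J class q q∈ p⊆q = αₛ , Hₛ ,
      (λ G K G⊊K i → Hₛ-increasing {G} {K} G⊊K (class (Fin.toℕ i))) ,
      λ G G-inc β β-inc f f∈ P P∈ →
      let open Run G G-inc f f∈
          (v , v-entries , w) = blocks (suc n) [] {0} (⨂-Win n p (A ∘ h) A∈)
            (λ P∈ _ → ∈-++⁺ˡ (∈-map⁺ (fresh []) P∈)) β β-inc (λ _ _ → s≤s z≤n) P P∈
      in v , v-entries , WinAfter-all (suc n) p (A ∘ h) v w
      where
      open Construction em ext p̂ (extend-all (_∈ Idempotent) (proj₂ ∘ p∈) (proj₂ (p∈ Fin.zero)))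
        (WinAfter (suc n) p (A ∘ h)) (WinAfter-next (suc n) p (p Fin.zero) (A ∘ h))
        J class q q∈ p⊆q Ps

    Common : Set₁
    Common = ∃[ p₀ ] (p₀ ∈ 𝒥ₚ-Idempotent × (∀ i → p i ≈ᵘ p₀))

    solution : Σ[ α ∈ (Fin (suc n) → 𝒫fFun⟶ℕ⁺) ] Σ[ H ∈ (Fin (suc n) → 𝒫fFun⟶𝒫fℕ) ]
      (Increasing H × Captures h A Ps α H × (Common → Uniform α H))
    -- The functions must be given before the hypothesis of (3), so it is decided first. If it
    -- holds, one class with the ultrafilter `p₀` is used; otherwise each coordinate is its own
    -- class and (3) is vacuous.
    solution with em {P = Common}
    ... | yes (p₀ , (p₀∈ , _) , p≈p₀) =
      let (α , H , inc , cap) = captures ⊤ (λ _ → tt) (λ _ → p₀) (λ _ → p₀∈)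
            (extend-all (λ u → ∀ B → B ∈ᵘ u → B ∈ᵘ p₀) (λ i B → proj₁ (p≈p₀ i))
              (λ B → proj₁ (p≈p₀ Fin.zero)))
      in (λ _ → α tt) , (λ _ → H tt) , inc , cap , λ _ → α tt , H tt , λ _ _ → refl , refl
    ... | no none =
      let (α , H , inc , cap) = captures ℕ (λ k → k) p̂
            (extend-all (_∈ 𝒥ₚ) (proj₁ ∘ p∈) (proj₁ (p∈ Fin.zero)))
            (λ _ _ B∈ → B∈)
      in (λ i → α (Fin.toℕ i)) , (λ i → H (Fin.toℕ i)) , inc , cap , λ common → ⊥-elim (none common)

corollary1p34 : (∀ {ℓ} → ExcludedMiddle ℓ) →
    (∀ {a b} → Extensionality a b) →
    (m : ℕ) .{{_ : NonZero m}} →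
    (h : Vec ℕ⁺ m → ℕ⁺) → IsPolynomialWithoutConstantTerm h →
    ( (p : Fin m → βℕ) → (∀ i → MinimalIdempotent (p i)) →
    (A : Pred ℕ⁺ 0ℓ) → A ∈ᵘ (h ~) (⨂ p) → (T : List⁺ ℙ) →
    Σ[ α ∈ (Fin m → 𝒫fFun⟶ℕ⁺) ] Σ[ H ∈ (Fin m → 𝒫fFun⟶𝒫fℕ) ]
    ( Increasing H
    × Captures h A T α H
    × ((∃[ p₀ ] (MinimalIdempotent p₀ × (∀ i → p i ≈ᵘ p₀))) → Uniform α H)))
    ×
    ( (p : Fin m → βℕ) → (∀ i → 𝒥ₚ-Idempotent (p i)) →
    (A : Pred ℕ⁺ 0ℓ) → A ∈ᵘ (h ~) (⨂ p) → (T : List⁺ ℙ) →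
    Σ[ α ∈ (Fin m → 𝒫fFun⟶ℕ⁺) ] Σ[ H ∈ (Fin m → 𝒫fFun⟶𝒫fℕ) ]
    ( Increasing H
    × Captures h A T α H
    × ((∃[ p₀ ] (𝒥ₚ-Idempotent p₀ × (∀ i → p i ≈ᵘ p₀))) → Uniform α H)))
corollary1p34 em ext (suc n) h _ =
  (λ p p∈ A A∈ Ps →
    let (α , H , inc , cap , uniform) = solution em ext h p (λ i → 𝒥ₚ-idempotent (p∈ i)) A A∈ Ps
    in α , H , inc , cap , λ { (p₀ , p₀∈ , p≈p₀) → uniform (p₀ , 𝒥ₚ-idempotent p₀∈ , p≈p₀) }) ,
  solution em ext h
  where
  𝒥ₚ-idempotent : ∀ {p} → MinimalIdempotent p → 𝒥ₚ-Idempotent p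
  𝒥ₚ-idempotent (p∈K , idem) = K⊆𝒥ₚ em ext p∈K , idem
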